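{- Let $q=p^t$ with $p$ prime and $t\ge1$, and let $k\ge1$. Let $H\le C_q^k$ and let $W\le\mathbb F_p^k$ be a subspace with $W>V_H$ and $\dim W=\dim V_H+1$; regard $W$ as a subgroup of $C_p^k\le C_q^k\cong\Omega$. Let $\Phi$ be an $\mathsf{AC}$ formula of depth at most $d$ over the variables of $\Omega$. Suppose $\Phi$ is $H$-invariant, and the function computed by $\Phi$, restricted to the inputs in $W$, is nonconstant. Then for $d\ge1$, \[ \mathrm{size}(\Phi)\ \ge\ \frac{|H|\,q^{d(\mu(V_H,W)^{1/d}-1)}}{q^{\dim V_H}}. \] Moreover, as $d\to\infty$ the bound becomes $\mathrm{size}(\Phi)\ge |H|\,q^{\log_2\mu(V_H,W)}/q^{\dim V_H}$.
   Context: Identify $C_q$ with $\mathbb Z/q\mathbb Z$, acting regularly on $q$ points, so $C_q\le S_q$. Let $\overline{C_q}$ be its set of permutation matrices, and let $\Omega=\overline{C_q}^k\subseteq\{0,1\}^{kq^2}$, with variables the matrix entries. Identify $\Omega$ with $C_q^k$ via $(x_1,\dots,x_k)\mapsto(\overline{x_1},\dots,\overline{x_k})$. Then $C_q^k$ acts on $\Omega$ by $(x_1,\dots,x_k)(M_1,\dots,M_k)=(\overline{x_1}M_1,\dots,\overline{x_k}M_k)$ (translation), which is a faithful permutation of the variables. $C_p\le C_q$ is the unique subgroup of order $p$ (the multiples of $p^{t-1}$), identified with $\mathbb F_p$. For $H\le C_q^k$, $V_H=H\cap C_p^k$, regarded as a subspace of $\mathbb F_p^k$. For $x\in\mathbb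 F_p^k$, $|x|$ is the number of nonzero coordinates, and $V^\perp$ is the orthogonal complement of $V$ under the standard dot product. For $V<W\le\mathbb F_p^k$ with $\dim W=\dim V+1$, $\mu(V,W)=\min_{v\in V^\perp\setminus W^\perp}|v|$. $\mathsf{AC}$ formulas are rooted trees with unordered children. Leaves are labeled $0,1$ or literals $x_i,\neg x_i$, and gates are unbounded fan-in $\textsc{and}$ or $\textsc{or}$. Formulas are taken up to labeled-tree isomorphism. Depth is the maximum number of gates on a root-leaf path; size is the number of literal leaves. A group acting on the variables acts on formulas by relabeling literals, and $\Phi$ is $H$-invariant if $h\Phi=\Phi$ for all $h\in H$. -}

module Defs where

open import Data.Bool.Base using (Bool; true; false; not; _∧_; _∨_)
open import Data.Fin.Base using (Fin; toℕ)
open import Data.Fin.Permutation using (Permutation; _⟨$⟩ʳ_)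
open import Data.Fin.Properties using (_≟_; toℕ-fromℕ<; fromℕ<-cong)
open import Data.List.Base using (List; []; _∷_; length; filter; allFin; cartesianProductWith)
open import Data.Nat.Base using (ℕ; zero; suc; _+_; _*_; _∸_; _^_; _⊔_; _≤_; NonZero; s≤s)
open import Data.Nat.DivMod using (_%_; _mod_; m%n<n; m%n%n≡m%n; %-distribˡ-+; m%n*o≡m*o%[n*o])
open import Data.Nat.Properties using (*-distribʳ-+)
open import Data.Product.Base using (_×_; _,_; ∃-syntax)
open import Data.Vec.Base as Vec using (Vec; []; _∷_; map; zipWith; replicate; lookup; count)
open import Data.Vec.Functional as Functional using (Vector)
open import Data.Vec.Relation.Unary.All using (All)
open import Level using (0ℓ)
open import Relation.Binary.PropositionalEquality using (_≡_; _≢_; refl; sym; trans; cong; cong₂; subst; module ≡-Reasoning)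
open import Relation.Nullary.Decidable using (does; ¬?)
open import Relation.Unary using (Pred; Decidable; _∈_; _∉_)

module _ {n : ℕ} .{{_ : NonZero n}} where

  infixl 6 _⊕_
  infixl 7 _⊗_

  0# : Fin n
  0# = 0 mod n

  _⊕_ : Fin n → Fin n → Fin n
  a ⊕ b = (toℕ a + toℕ b) mod n

  _⊗_ : Fin n → Fin n → Fin n
  a ⊗ b = (toℕ a * toℕ b) mod n

  ⊖_ : Fin n → Fin n
  ⊖ a = (n ∸ toℕ a) mod n

  infixl 6 _⊕ᵛ_
  infixr 7 _⊗ᵛ_

  0ᵛ : ∀ {k} → Vec (Fin n) k
  0ᵛ = replicate _ 0#

  _⊕ᵛ_ : ∀ {k} → Vec (Fin n) k → Vec (Fin n) k → Vec (Fin n) k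
  _⊕ᵛ_ = zipWith _⊕_

  ⊖ᵛ_ : ∀ {k} → Vec (Fin n) k → Vec (Fin n) k
  ⊖ᵛ_ = map ⊖_

  _⊗ᵛ_ : ∀ {k} → Fin n → Vec (Fin n) k → Vec (Fin n) k
  c ⊗ᵛ x = map (c ⊗_) x

  dot : ∀ {k} → Vec (Fin n) k → Vec (Fin n) k → Fin n
  dot x y = Vec.foldr _ _⊕_ 0# (zipWith _⊗_ x y)

  weight : ∀ {k} → Vec (Fin n) k → ℕ
  weight = count (λ a → ¬? (a ≟ 0#))

  linearCombination : ∀ {k r} → Vec (Fin n) r → Vec (Vec (Fin n) k) r → Vec (Fin n) k
  linearCombination cs vs = Vec.foldr _ _⊕ᵛ_ 0ᵛ (zipWith _⊗ᵛ_ cs vs)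

allVecs : ∀ n k → List (Vec (Fin n) k)
allVecs n zero    = [] ∷ []
allVecs n (suc k) = cartesianProductWith _∷_ (allFin n) (allVecs n k)

-- Membership is decidable so that the order of the subgroup is defined.
record Subgroup (n k : ℕ) .{{_ : NonZero n}} : Set₁ where
  field
    Member   : Pred (Vec (Fin n) k) 0ℓ
    member?  : Decidable Member
    0∈       : 0ᵛ ∈ Member
    ⊕-closed : ∀ {x y} → x ∈ Member → y ∈ Member → x ⊕ᵛ y ∈ Member
    ⊖-closed : ∀ {x} → x ∈ Member → ⊖ᵛ x ∈ Member

∣_∣ : ∀ {n k} .{{_ : NonZero n}} → Subgroup n k → ℕ
∣_∣ {n} {k} H = length (filter (Subgroup.member? H) (allVecs n k))

-- A subspace of 𝔽ₚᵏ when p is prime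
record Subspace (p k : ℕ) .{{_ : NonZero p}} : Set₁ where
  field
    Member   : Pred (Vec (Fin p) k) 0ℓ
    0∈       : 0ᵛ ∈ Member
    ⊕-closed : ∀ {x y} → x ∈ Member → y ∈ Member → x ⊕ᵛ y ∈ Member
    ⊗-closed : ∀ c {x} → x ∈ Member → c ⊗ᵛ x ∈ Member

module _ {p k : ℕ} .{{_ : NonZero p}} where

  open Subspace using (Member)

  record IsBasis (V : Subspace p k) {r : ℕ} (vs : Vec (Vec (Fin p) k) r) : Set where
    field
      members     : All (_∈ Member V) vs
      independent : ∀ cs → linearCombination cs vs ≡ 0ᵛ → cs ≡ 0ᵛ
      spanning    : ∀ {v} → v ∈ Member V → ∃[ cs ] linearCombination cs vs ≡ v

  -- dim V = r
  HasDimension : Subspace p k → ℕ → Set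
  HasDimension V r = ∃[ vs ] IsBasis V {r} vs

  infix 8 _^⊥

  _^⊥ : Subspace p k → Pred (Vec (Fin p) k) 0ℓ
  (V ^⊥) v = ∀ x → x ∈ Member V → dot x v ≡ 0#

  -- m = μ(V,W), the minimum of |v| over v ∈ V^⊥ ∖ W^⊥
  record IsMu (V W : Subspace p k) (m : ℕ) : Set where
    field
      attained : ∃[ v ] v ∈ V ^⊥ × v ∉ W ^⊥ × weight v ≡ m
      minimal  : ∀ v → v ∈ V ^⊥ → v ∉ W ^⊥ → m ≤ weight v

-- The element a of 𝔽ₚ is the multiple a·pᵗ⁻¹ in ℤ/q.
embed : ∀ p t q .{{_ : NonZero q}} → Fin p → Fin q
embed p t q a = (toℕ a * p ^ (t ∸ 1)) mod q

embedᵛ : ∀ p t q .{{_ : NonZero q}} {k} → Vec (Fin p) k → Vec (Fin q) k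
embedᵛ p t q = map (embed p t q)

mod-cong : ∀ {a b} n .{{_ : NonZero n}} → a % n ≡ b % n → a mod n ≡ b mod n
mod-cong {a} {b} n eq = fromℕ<-cong _ _ eq (m%n<n a n) (m%n<n b n)

toℕ-mod : ∀ a n .{{_ : NonZero n}} → toℕ (a mod n) ≡ a % n
toℕ-mod a n = toℕ-fromℕ< (m%n<n a n)

mod-⊕ : ∀ a b n .{{_ : NonZero n}} → (a mod n) ⊕ (b mod n) ≡ (a + b) mod n
mod-⊕ a b n = mod-cong n (trans
  (cong (_% n) (cong₂ _+_ (toℕ-mod a n) (toℕ-mod b n)))
  (sym (%-distribˡ-+ a b n)))

module _ (p t q : ℕ) .{{_ : NonZero p}} .{{_ : NonZero q}} (1≤t : 1 ≤ t) (q≡p^t : q ≡ p ^ t) where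

  embed-mod : ∀ m → embed p t q (m mod p) ≡ (m * p ^ (t ∸ 1)) mod q
  embed-mod m = mod-cong q (go t q 1≤t q≡p^t)
    where
    go : ∀ t q .{{_ : NonZero q}} → 1 ≤ t → q ≡ p ^ t →
         (toℕ (m mod p) * p ^ (t ∸ 1)) % q ≡ (m * p ^ (t ∸ 1)) % q
    go (suc s) _ (s≤s _) refl = trans
      (cong (_% p ^ suc s) (trans (cong (_* p ^ s) (toℕ-mod m p)) (m%n*o≡m*o%[n*o] m p (p ^ s))))
      (m%n%n≡m%n (m * p ^ s) (p ^ suc s))

  embed-+ : ∀ m n → embed p t q ((m + n) mod p) ≡ embed p t q (m mod p) ⊕ embed p t q (n mod p)
  embed-+ m n = begin
    embed p t q ((m + n) mod p)                       ≡⟨ embed-mod (m + n) ⟩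
    ((m + n) * P) mod q                               ≡⟨ cong (_mod q) (*-distribʳ-+ P m n) ⟩
    (m * P + n * P) mod q                             ≡⟨ mod-⊕ (m * P) (n * P) q ⟨
    ((m * P) mod q) ⊕ ((n * P) mod q)                 ≡⟨ cong₂ _⊕_ (embed-mod m) (embed-mod n) ⟨
    embed p t q (m mod p) ⊕ embed p t q (n mod p)     ∎
    where
    open ≡-Reasoning
    P = p ^ (t ∸ 1)

  embed-⊕ : ∀ a b → embed p t q (a ⊕ b) ≡ embed p t q a ⊕ embed p t q b
  embed-⊕ a b = trans (embed-mod (toℕ a + toℕ b))
    (trans (cong (_mod q) (*-distribʳ-+ P (toℕ a) (toℕ b)))
           (sym (mod-⊕ (toℕ a * P) (toℕ b * P) q)))
    where P = p ^ (t ∸ 1)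

  embedᵛ-0 : ∀ k → embedᵛ p t q (0ᵛ {k = k}) ≡ 0ᵛ
  embedᵛ-0 zero    = refl
  embedᵛ-0 (suc k) = cong₂ _∷_ (embed-mod 0) (embedᵛ-0 k)

  embedᵛ-⊕ : ∀ {k} (x y : Vec (Fin p) k) → embedᵛ p t q (x ⊕ᵛ y) ≡ embedᵛ p t q x ⊕ᵛ embedᵛ p t q y
  embedᵛ-⊕ []      []      = refl
  embedᵛ-⊕ (a ∷ x) (b ∷ y) = cong₂ _∷_ (embed-⊕ a b) (embedᵛ-⊕ x y)

  multiple : ∀ {k} → ℕ → Vec (Fin p) k → Vec (Fin p) k
  multiple c = map (λ a → (c * toℕ a) mod p)

  embedᵛ-multiple-0 : ∀ {k} (x : Vec (Fin p) k) → embedᵛ p t q (multiple 0 x) ≡ 0ᵛ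
  embedᵛ-multiple-0 []      = refl
  embedᵛ-multiple-0 (a ∷ x) = cong₂ _∷_ (embed-mod 0) (embedᵛ-multiple-0 x)

  embedᵛ-multiple-suc : ∀ {k} c (x : Vec (Fin p) k) →
    embedᵛ p t q (multiple (suc c) x) ≡ embedᵛ p t q x ⊕ᵛ embedᵛ p t q (multiple c x)
  embedᵛ-multiple-suc c []      = refl
  embedᵛ-multiple-suc c (a ∷ x) = cong₂ _∷_
    (trans (embed-+ (toℕ a) (c * toℕ a)) (cong (_⊕ embed p t q ((c * toℕ a) mod p)) (embed-mod (toℕ a))))
    (embedᵛ-multiple-suc c x)

  -- H ∩ C_pᵏ, as a subspace of 𝔽ₚᵏ
  V[_] : ∀ {k} → Subgroup q k → Subspace p k
  V[_] {k} H = record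
    { Member   = λ x → embedᵛ p t q x ∈ Member
    ; 0∈       = subst Member (sym (embedᵛ-0 k)) 0∈
    ; ⊕-closed = λ {x} {y} x∈ y∈ → subst Member (sym (embedᵛ-⊕ x y)) (⊕-closed x∈ y∈)
    ; ⊗-closed = λ c x∈ → multiples (toℕ c) x∈
    }
    where
    open Subgroup H
    multiples : ∀ c {x} → embedᵛ p t q x ∈ Member → embedᵛ p t q (multiple c x) ∈ Member
    multiples zero    {x} x∈ = subst Member (sym (embedᵛ-multiple-0 x)) 0∈
    multiples (suc c) {x} x∈ =
      subst Member (sym (embedᵛ-multiple-suc c x)) (⊕-closed x∈ (multiples c x∈))

data Literal (X : Set) : Set where
  pos neg : X → Literal X

data Gate : Set where
  AND OR : Gate

-- A gate is an internal node, hence has at least one child.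
data Formula (X : Set) : Set where
  const : Bool → Formula X
  lit   : Literal X → Formula X
  gate  : Gate → ∀ {n} → Vector (Formula X) (suc n) → Formula X

module _ {X : Set} where

  infix 4 _≅_

  -- Labeled-tree isomorphism with unordered children: this is the equality of formulas.
  data _≅_ : Formula X → Formula X → Set where
    const : ∀ b → const b ≅ const b
    lit   : ∀ l → lit l ≅ lit l
    gate  : ∀ g {m n} {φ : Vector (Formula X) (suc m)} {ψ : Vector (Formula X) (suc n)}
            (π : Permutation (suc m) (suc n)) → (∀ i → φ i ≅ ψ (π ⟨$⟩ʳ i)) →
            gate g φ ≅ gate g ψ

  depth : Formula X → ℕ
  depth (const _)  = 0
  depth (lit _)    = 0
  depth (gate _ φ) = suc (Functional.foldr _⊔_ 0 (λ i → depth (φ i)))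

  size : Formula X → ℕ
  size (const _)  = 0
  size (lit _)    = 1
  size (gate _ φ) = Functional.foldr _+_ 0 (λ i → size (φ i))

  evalLiteral : (X → Bool) → Literal X → Bool
  evalLiteral ρ (pos x) = ρ x
  evalLiteral ρ (neg x) = not (ρ x)

  eval : Formula X → (X → Bool) → Bool
  eval (const b)    ρ = b
  eval (lit l)      ρ = evalLiteral ρ l
  eval (gate AND φ) ρ = Functional.foldr _∧_ true  (λ i → eval (φ i) ρ)
  eval (gate OR  φ) ρ = Functional.foldr _∨_ false (λ i → eval (φ i) ρ)

  relabelLiteral : (X → X) → Literal X → Literal X
  relabelLiteral σ (pos x) = pos (σ x)
  relabelLiteral σ (neg x) = neg (σ x)

  relabel : (X → X) → Formula X → Formula X
  relabel σ (const b)  = const b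
  relabel σ (lit l)    = lit (relabelLiteral σ l)
  relabel σ (gate g φ) = gate g (λ i → relabel σ (φ i))

-- The matrix of the permutation b ↦ x + b
permutationMatrix : ∀ {q} .{{_ : NonZero q}} → Fin q → Fin q → Fin q → Bool
permutationMatrix x a b = does (a ≟ x ⊕ b)

-- (i , a , b) is the entry in row a and column b of the i-th matrix.
Variable : ℕ → ℕ → Set
Variable q k = Fin k × Fin q × Fin q

module _ {q k : ℕ} .{{_ : NonZero q}} where

  point : Vec (Fin q) k → Variable q k → Bool
  point x (i , a , b) = permutationMatrix (lookup x i) a b

  -- Left multiplication by the matrix of xᵢ moves row a of the i-th matrix to row xᵢ + a.
  translate : Vec (Fin q) k → Variable q k → Variable q k
  translate x (i , a , b) = i , lookup x i ⊕ a , b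

  Invariant : Subgroup q k → Formula (Variable q k) → Set
  Invariant H Φ = ∀ h → h ∈ Subgroup.Member H → relabel (translate h) Φ ≅ Φ

NonconstantOn : {A : Set} → Pred A 0ℓ → (A → Bool) → Set
NonconstantOn P f = ∃[ x ] ∃[ y ] x ∈ P × y ∈ P × f x ≢ f y

-- A real α ≥ 0 is given by its set of fractions: α a b, for b ≠ 0, means a/b ≤ α.
Cut : Set₁
Cut = ℕ → ℕ → Set

-- The real number m^(1/d), for d ≥ 1
root : ℕ → ℕ → Cut
root d m a b = a ^ d ≤ m * b ^ d

-- The real number α − 1, for α ≥ 1
minusOne : Cut → Cut
minusOne α a b = α (a + b) b

-- The real number n·α, for n ≥ 1
times : ℕ → Cut → Cut
times n α a b = α a (n * b)

-- The real number log₂ m, for m ≥ 1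
log₂ : ℕ → Cut
log₂ m a b = 2 ^ a ≤ m ^ b

-- A·q^α ≤ B, for q ≥ 1, where q^α is the supremum of q^(a/b) over the fractions
-- 0 ≤ a/b ≤ α; A·q^(a/b) ≤ B is stated as its b-th power.
ScaledPower≤ : ℕ → ℕ → Cut → ℕ → Set
ScaledPower≤ A q α B = ∀ a b .{{_ : NonZero b}} → α a b → A ^ b * q ^ a ≤ B ^ b

{-# OPTIONS --safe #-}
module Submission where

open import Defs
open import Algebra.Bundles using (AbelianGroup; CommutativeRing)
import Algebra.Properties.CommutativeMonoid.Sum as CommutativeMonoidSum
import Algebra.Properties.CommutativeSemigroup as CommutativeSemigroupProperties
import Algebra.Properties.Group as GroupProperties
import Algebra.Properties.Ring as RingProperties
open import Data.Bool.Base using (Bool; true; false; not; _∧_; _∨_)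
import Data.Bool.Properties as Bool
open import Data.Fin.Base using (Fin; zero; suc; toℕ)
open import Data.Fin.Permutation as Perm using (_⟨$⟩ʳ_; _⟨$⟩ˡ_)
import Data.Fin.Properties as Fin
open import Data.List.Base using (List; []; _∷_; length; filter; map; allFin; tabulate; cartesianProduct; cartesianProductWith)
open import Data.List.Extrema.Nat using (argmin; argmin-all; f[argmin]≤f[xs])
open import Data.List.Membership.Propositional using (find; lose) renaming (_∈_ to _∈ˡ_)
open import Data.List.Membership.Propositional.Properties using (∈-filter⁺; ∈-filter⁻; ∈-map⁺; ∈-cartesianProductWith⁺; ∈-cartesianProduct⁻; ∈-allFin)
open import Data.List.Properties using (map-tabulate; length-map; length-++; length-tabulate)
open import Data.List.Relation.Unary.All as All using (All; []; _∷_)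
open import Data.List.Relation.Unary.All.Properties using (¬All⇒Any¬)
open import Data.List.Relation.Unary.AllPairs using ([]; _∷_)
open import Data.List.Relation.Unary.Any as Any using (Any; here; there)
open import Data.List.Relation.Unary.Unique.Propositional using (Unique)
import Data.List.Relation.Unary.Unique.Propositional.Properties as Unique
open import Data.Nat.Base
open import Data.Nat.Coprimality using (prime⇒coprime; coprime-Bézout)
open import Data.Nat.DivMod using (_mod_; _%_; m<n⇒m%n≡m; %-distribˡ-*; m*n%n≡0)
open import Data.Nat.Divisibility using (_∣_; divides; *-cancelˡ-∣; m%n≡0⇒n∣m)
open import Data.Nat.GCD using (module Bézout)
open import Data.Nat.ListAction using (sum)
open import Data.Nat.Primality using (Prime; prime⇒nonTrivial)
open import Data.Nat.Properties hiding (_≟_)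
open import Data.Nat.Tactic.RingSolver using (solve-∀)
open import Data.Product.Base using (_×_; _,_; proj₁; proj₂; ∃-syntax)
open import Data.Sum.Base using (_⊎_; inj₁; inj₂)
open import Data.Vec.Base using (Vec; []; _∷_; lookup)
open import Data.Vec.Functional as Functional using (Vector)
import Data.Vec.Properties as Vec
import Data.Vec.Relation.Unary.All as Vec
open import Data.Vec.Relation.Unary.All using ([]; _∷_)
open import Function.Bundles using (mk⇔)
open import Level using (0ℓ)
open import Relation.Binary.Definitions using (DecidableEquality)
open import Relation.Binary.PropositionalEquality
open import Relation.Nullary.Decidable using (Dec; yes; no; does; ¬?; _×-dec_; map′; does-⇔; decidable-stable; ¬¬-excluded-middle)
open import Relation.Nullary.Negation using (contradiction; ¬_)
open import Relation.Unary using (Pred; Decidable; _∈_; _⊂_)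

-- Induction on Φ, for W = V_H + ⟨w⟩. If Φ is a gate, choose a child Ψ that is nonconstant on W and let K be its
-- stabilizer in H. The H-orbit of Ψ consists of children, so |H| · size Ψ ≤ size Φ · |K|. Linear algebra gives
-- i ≤ dim V_H − dim V_K and y ∈ V_H with μ(V_H,W) ≤ (i + 1) μ(V_K, V_K + ⟨w + y⟩), and some child in the orbit
-- of Ψ, which is again K-invariant, is nonconstant on V_K + ⟨w + y⟩. Dividing μ by i + 1 costs at most a factor qⁱ,
-- by the inequality of arithmetic and geometric means (or by i + 1 ≤ 2ⁱ when the depth is unbounded), and
-- q^dim V_K ≤ q^dim V_H / qⁱ makes up for it. If Φ is a literal, then μ = 1 and the bound reads |H| ≤ q^dim V_H.

-- Admissible exponents

-- A K-invariant child is constant only along the cosets of the smaller space V_K, so W has to give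
-- way to an extension of V_K by one line. The candidates ⟨w + y⟩ with y in V_H have different
-- minimal weights, and that of ⟨w⟩ itself can be far below μ(V_H,W); the linear algebra therefore
-- needs the freedom to choose y. Two facts make this choice affordable. Where an H-invariant gate
-- takes the value that forces all its children, it does so on a whole coset of V_H, so every child
-- agrees there whatever y is. At the other point, translating child and point together by an
-- element of H preserves the value, and since the group is abelian the translated child keeps the
-- stabilizer K. Real exponents appear only through fractions a/b, and the induction proves the b-th
-- power of the inequality for each fraction. It uses just two properties of the set of fractions,
-- so one induction yields both bounds. Dimensions enter as cardinality bounds by powers of p, so no
-- basis of V_K is ever constructed.

^-distribʳ-* : ∀ n x y → (x * y) ^ n ≡ x ^ n * y ^ n
^-distribʳ-* zero    x y = refl
^-distribʳ-* (suc n) x y = trans (cong (x * y *_) (^-distribʳ-* n x y)) (lemma x y (x ^ n) (y ^ n))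
  where
  lemma : ∀ x y u v → x * y * (u * v) ≡ x * u * (y * v)
  lemma = solve-∀

*-rearrangement : ∀ {a b c d} → a ≤ b → c ≤ d → a * d + b * c ≤ a * c + b * d
*-rearrangement {a} {b} {c} {d} a≤b c≤d
  with x , refl ← m≤n⇒∃[o]m+o≡n a≤b | y , refl ← m≤n⇒∃[o]m+o≡n c≤d =
  subst (a * (c + y) + (a + x) * c ≤_) (lemma a x c y) (m≤m+n _ (x * y))
  where
  lemma : ∀ a x c y → a * (c + y) + (a + x) * c + x * y ≡ a * c + (a + x) * (c + y)
  lemma = solve-∀

^-rearrangement : ∀ u v n → u ^ n * v + u * v ^ n ≤ u ^ suc n + v ^ suc n
^-rearrangement u v n with ≤-total u v
... | inj₁ u≤v = subst₂ _≤_
  (cong (u ^ n * v +_) (*-comm (v ^ n) u))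
  (cong₂ _+_ (*-comm (u ^ n) u) (*-comm (v ^ n) v))
  (*-rearrangement (^-monoˡ-≤ n u≤v) u≤v)
... | inj₂ v≤u = subst₂ _≤_
  (trans (+-comm (v ^ n * u) (u ^ n * v)) (cong (u ^ n * v +_) (*-comm (v ^ n) u)))
  (trans (+-comm (v ^ n * v) (u ^ n * u)) (cong₂ _+_ (*-comm (u ^ n) u) (*-comm (v ^ n) v)))
  (*-rearrangement (^-monoˡ-≤ n v≤u) v≤u)

-- This is 1 + (n + 1)(x - 1) ≤ x^(n+1) at x = u/v, multiplied by v^(n+1) and arranged so that
-- nothing is subtracted.
bernoulli : ∀ u v n → suc n * (u * v ^ n) ≤ u ^ suc n + n * v ^ suc n
bernoulli u v zero    = ≤-reflexive (lemma u)
  where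
  lemma : ∀ u → 1 * (u * 1) ≡ u * 1 + 0
  lemma = solve-∀
bernoulli u v (suc n) = begin
  suc (suc n) * (u * (v * v ^ n))                     ≡⟨ lemma₁ n u v (v ^ n) ⟩
  suc n * (u * v ^ n) * v + u * (v * v ^ n)           ≤⟨ +-monoˡ-≤ _ (*-monoˡ-≤ v (bernoulli u v n)) ⟩
  (u ^ suc n + n * v ^ suc n) * v + u * v ^ suc n     ≡⟨ lemma₂ n u v (u ^ suc n) (v ^ suc n) ⟩
  u ^ suc n * v + u * v ^ suc n + n * v ^ suc (suc n) ≤⟨ +-monoˡ-≤ _ (^-rearrangement u v (suc n)) ⟩
  u ^ suc (suc n) + v ^ suc (suc n) + n * v ^ suc (suc n) ≡⟨ +-assoc (u ^ suc (suc n)) _ _ ⟩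
  u ^ suc (suc n) + suc n * v ^ suc (suc n)           ∎
  where
  open ≤-Reasoning
  lemma₁ : ∀ n u v x → (2 + n) * (u * (v * x)) ≡ (1 + n) * (u * x) * v + u * (v * x)
  lemma₁ = solve-∀
  lemma₂ : ∀ n u v x y → (x + n * y) * v + u * y ≡ x * v + u * y + n * (v * y)
  lemma₂ = solve-∀

-- AM-GM for the number Y and e copies of X/e: this is bernoulli with u = e(X + Y) and v = (e + 1)X.
amgm : ∀ e .{{_ : NonZero e}} X Y → suc e ^ suc e * (X ^ e * Y) ≤ e ^ e * (X + Y) ^ suc e
amgm e X Y = *-cancelˡ-≤ e (+-cancelʳ-≤ (e * v ^ suc e) _ _ (begin
  e * (suc e ^ suc e * (X ^ e * Y)) + e * v ^ suc e       ≡⟨ cong (λ z → e * (suc e ^ suc e * (X ^ e * Y)) + e * (v * z)) (^-distribʳ-* e (suc e) X) ⟩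
  e * (suc e ^ suc e * (X ^ e * Y)) + e * (v * (suc e ^ e * X ^ e)) ≡⟨ lemma₁ e X Y (suc e ^ e) (X ^ e) ⟩
  suc e * (u * (suc e ^ e * X ^ e))                       ≡⟨ cong (λ z → suc e * (u * z)) (^-distribʳ-* e (suc e) X) ⟨
  suc e * (u * v ^ e)                                     ≤⟨ bernoulli u v e ⟩
  u ^ suc e + e * v ^ suc e                               ≡⟨ cong (_+ e * v ^ suc e) (trans (^-distribʳ-* (suc e) e (X + Y)) (*-assoc e (e ^ e) _)) ⟩
  e * (e ^ e * (X + Y) ^ suc e) + e * v ^ suc e           ∎))
  where
  open ≤-Reasoning
  u = e * (X + Y)
  v = suc e * X
  lemma₁ : ∀ e X Y s x → e * ((1 + e) * s * (x * Y)) + e * ((1 + e) * X * (s * x)) ≡ (1 + e) * (e * (X + Y) * (s * x))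
  lemma₁ = solve-∀

^-cancelˡ-≤ : ∀ {m n} d .{{_ : NonZero d}} → m ^ d ≤ n ^ d → m ≤ n
^-cancelˡ-≤ {m} {n} d m^d≤n^d = ≮⇒≥ λ n<m → <⇒≱ (^-monoˡ-< d n<m) m^d≤n^d

suc≤2^ : ∀ i → suc i ≤ 2 ^ i
suc≤2^ zero    = ≤-refl
suc≤2^ (suc i) = begin
  suc (suc i)     ≤⟨ +-mono-≤ (m^n>0 2 i) (suc≤2^ i) ⟩
  2 ^ i + 2 ^ i   ≡⟨ cong (2 ^ i +_) (+-identityʳ (2 ^ i)) ⟨
  2 ^ suc i       ∎
  where open ≤-Reasoning

-- Q d m a b says that a/b is an admissible exponent for a formula of depth ≤ d when the minimal weight is m.
record Admissible (Q : ℕ → ℕ → ℕ → ℕ → Set) : Set where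
  field
    leaf : ∀ d {m a b} .{{_ : NonZero b}} → m ≤ 1 → Q d m a b → a ≡ 0
    -- A child may lose i from the exponent a/b, because the drop of the dimension by i returns the
    -- factor qⁱ. A negative exponent is truncated to 0.
    step : ∀ d i {m m′ a b} .{{_ : NonZero b}} → m ≤ suc i * m′ → Q (suc d) m a b → Q d m′ (a ∸ i * b) b

-- The value at depth 0 is the limit of d(m^(1/d) - 1) as d tends to 0: it is 0 for m ≤ 1 and
-- infinite otherwise, when every fraction is admissible.
rootExponent : ℕ → ℕ → ℕ → ℕ → Set
rootExponent zero    m a b = m ≤ 1 → a ≡ 0
rootExponent (suc d) m     = times (suc d) (minusOne (root (suc d) m))

private
  root-leaf : ∀ d {m a b} .{{_ : NonZero b}} → m ≤ 1 → rootExponent d m a b → a ≡ 0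
  root-leaf zero    m≤1 Q = Q m≤1
  root-leaf (suc d) {m} {a} {b} m≤1 Q = n≤0⇒n≡0 (+-cancelʳ-≤ N a 0 (^-cancelˡ-≤ (suc d) (begin
    (a + N) ^ suc d    ≤⟨ Q ⟩
    m * N ^ suc d      ≤⟨ *-monoˡ-≤ (N ^ suc d) m≤1 ⟩
    1 * N ^ suc d      ≡⟨ *-identityˡ (N ^ suc d) ⟩
    N ^ suc d          ∎)))
    where
    open ≤-Reasoning
    N = suc d * b

  -- In real numbers, AM-GM for e copies of m′^(1/e) and one of i + 1 gives (e + 1)·m^(1/(e+1)) ≤
  -- e·m′^(1/e) + i + 1; subtracting e + 1 compares the two exponents. From depth 1 to depth 0 only
  -- m′ ≤ 1 matters, and then m ≤ i + 1 bounds a/b by i.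
  root-step : ∀ d i {m m′ a b} .{{_ : NonZero b}} → m ≤ suc i * m′ →
              rootExponent (suc d) m a b → rootExponent d m′ (a ∸ i * b) b
  root-step zero i {m} {m′} {a} {b} m≤ Q m′≤1 = m≤n⇒m∸n≡0 (+-cancelʳ-≤ b a (i * b) (begin
    a + b              ≡⟨ lemma a b ⟩
    (a + 1 * b) ^ 1    ≤⟨ Q ⟩
    m * (1 * b) ^ 1    ≤⟨ *-monoˡ-≤ _ (≤-trans m≤ (*-monoʳ-≤ (suc i) m′≤1)) ⟩
    suc i * 1 * (1 * b) ^ 1 ≡⟨ lemma′ i b ⟩
    i * b + b          ∎))
    where
    open ≤-Reasoning
    lemma : ∀ a b → a + b ≡ (a + 1 * b) * 1
    lemma = solve-∀
    lemma′ : ∀ i b → (1 + i) * 1 * (1 * b * 1) ≡ i * b + b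
    lemma′ = solve-∀
  root-step e@(suc _) i {m} {m′} {a} {b} m≤ Q with ≤-total a (i * b)
  -- The new exponent is 0, which is admissible once m′ is nonzero; m′ = 0 would make the right-hand
  -- side of `Q` vanish.
  ... | inj₁ a≤ib rewrite m≤n⇒m∸n≡0 a≤ib = m≤n*m ((e * b) ^ e) m′ {{≢-nonZero m′≢0}}
    where
    m′≢0 : m′ ≢ 0
    m′≢0 refl = <⇒≱ (m^n>0 (a + suc e * b) {{>-nonZero (≤-trans (>-nonZero⁻¹ b) (≤-trans (m≤m+n b _) (m≤n+m _ a)))}} (suc e))
      (≤-trans Q (≤-reflexive (cong (_* (suc e * b) ^ suc e) (n≤0⇒n≡0 (≤-trans m≤ (≤-reflexive (*-zeroʳ (suc i))))))))
  ... | inj₂ ib≤a = *-cancelʳ-≤ (X ^ e) (m′ * (e * b) ^ e) Y {{m*n≢0 (suc i) b}} (*-cancelˡ-≤ (suc e ^ suc e) {{m^n≢0 (suc e) (suc e)}} (begin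
    suc e ^ suc e * (X ^ e * Y)                     ≤⟨ amgm e X Y ⟩
    e ^ e * (X + Y) ^ suc e                         ≡⟨ cong (λ z → e ^ e * z ^ suc e) X+Y ⟩
    e ^ e * (a + suc e * b) ^ suc e                 ≤⟨ *-monoʳ-≤ (e ^ e) (≤-trans Q (*-monoˡ-≤ _ m≤)) ⟩
    e ^ e * (suc i * m′ * (suc e * b) ^ suc e)      ≡⟨ cong (λ z → e ^ e * (suc i * m′ * z)) (^-distribʳ-* (suc e) (suc e) b) ⟩
    e ^ e * (suc i * m′ * (suc e ^ suc e * b ^ suc e)) ≡⟨ lemma (e ^ e) i m′ (suc e ^ suc e) b (b ^ e) ⟩
    suc e ^ suc e * (m′ * (e ^ e * b ^ e) * Y)      ≡⟨ cong (λ z → suc e ^ suc e * (m′ * z * Y)) (^-distribʳ-* e e b) ⟨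
    suc e ^ suc e * (m′ * (e * b) ^ e * Y)          ∎))
    where
    open ≤-Reasoning
    -- The goal is X/(eb) ≤ m′^(1/e), and Y completes X to the base a + (e + 1)b that occurs in `Q`.
    X = a ∸ i * b + e * b
    Y = suc i * b
    X+Y : X + Y ≡ a + suc e * b
    X+Y = trans (regroup (a ∸ i * b) e i b) (cong (_+ suc e * b) (m∸n+n≡m ib≤a))
      where
      regroup : ∀ x e i b → x + e * b + (1 + i) * b ≡ x + i * b + (1 + e) * b
      regroup = solve-∀
    lemma : ∀ E i m s b x → E * ((1 + i) * m * (s * (b * x))) ≡ s * (m * (E * x) * ((1 + i) * b))
    lemma = solve-∀

root-admissible : Admissible rootExponent
root-admissible = record { leaf = root-leaf ; step = root-step }

-- As d grows, d(m^(1/d) - 1) tends only to the natural logarithm of m. The larger log₂ m is reached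
-- because i is an integer: i + 1 ≤ 2ⁱ fails for real i between 0 and 1.
log-admissible : Admissible (λ _ → log₂)
log-admissible = record { leaf = λ _ {m} {a} {b} → log-leaf m a b ; step = λ _ i → log-step i }
  where
  open ≤-Reasoning
  log-leaf : ∀ m a b → m ≤ 1 → log₂ m a b → a ≡ 0
  log-leaf m zero    b m≤1 Q = refl
  log-leaf m (suc a) b m≤1 Q = contradiction (begin
    2               ≤⟨ *-monoʳ-≤ 2 (m^n>0 2 a) ⟩
    2 * 2 ^ a       ≤⟨ Q ⟩
    m ^ b           ≤⟨ ^-monoˡ-≤ b m≤1 ⟩
    1 ^ b           ≡⟨ ^-zeroˡ b ⟩
    1               ∎) λ { (s≤s ()) }
  log-step : ∀ i {m m′ a b} .{{_ : NonZero b}} → m ≤ suc i * m′ → log₂ m a b → log₂ m′ (a ∸ i * b) b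
  log-step i {m} {m′} {a} {b} m≤ Q = *-cancelˡ-≤ (2 ^ (i * b)) {{m^n≢0 2 (i * b)}} (begin
    2 ^ (i * b) * 2 ^ (a ∸ i * b)  ≡⟨ ^-distribˡ-+-* 2 (i * b) (a ∸ i * b) ⟨
    2 ^ (i * b + (a ∸ i * b))      ≤⟨ bound (≤-total a (i * b)) ⟩
    2 ^ (i * b) * m′ ^ b           ∎)
    where
    bound : _ → _
    bound (inj₁ a≤ib) = begin
      2 ^ (i * b + (a ∸ i * b))  ≡⟨ cong (λ z → 2 ^ (i * b + z)) (m≤n⇒m∸n≡0 a≤ib) ⟩
      2 ^ (i * b + 0)            ≡⟨ cong (2 ^_) (+-identityʳ (i * b)) ⟩
      2 ^ (i * b)                ≤⟨ m≤m*n (2 ^ (i * b)) (m′ ^ b) {{m^n≢0 m′ b {{≢-nonZero m′≢0}}}} ⟩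
      2 ^ (i * b) * m′ ^ b       ∎
      where
      m′≢0 : m′ ≢ 0
      m′≢0 refl = <⇒≱ (m^n>0 2 a) (begin
        2 ^ a              ≤⟨ Q ⟩
        m ^ b              ≤⟨ ^-monoˡ-≤ b m≤ ⟩
        (suc i * 0) ^ b    ≡⟨ cong (_^ b) (*-zeroʳ (suc i)) ⟩
        0 ^ b              ≤⟨ 0^b≤0 ⟩
        0                  ∎)
        where
        0^b≤0 : 0 ^ b ≤ 0
        0^b≤0 = ≤-reflexive (cong (0 ^_) (sym (suc-pred b)))
    bound (inj₂ ib≤a) = begin
      2 ^ (i * b + (a ∸ i * b))  ≡⟨ cong (2 ^_) (m+[n∸m]≡n ib≤a) ⟩
      2 ^ a                      ≤⟨ Q ⟩
      m ^ b                      ≤⟨ ^-monoˡ-≤ b m≤ ⟩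
      (suc i * m′) ^ b           ≡⟨ ^-distribʳ-* b (suc i) m′ ⟩
      suc i ^ b * m′ ^ b         ≤⟨ *-monoˡ-≤ (m′ ^ b) (^-monoˡ-≤ b (suc≤2^ i)) ⟩
      (2 ^ i) ^ b * m′ ^ b       ≡⟨ cong (_* m′ ^ b) (^-*-assoc 2 i b) ⟩
      2 ^ (i * b) * m′ ^ b       ∎

-- Counting

module _ {A : Set} {P : Pred A 0ℓ} (P? : Decidable P) where

  length-filter-¬ : ∀ xs → length xs ≡ length (filter P? xs) + length (filter (λ x → ¬? (P? x)) xs)
  length-filter-¬ []       = refl
  length-filter-¬ (x ∷ xs) with does (P? x)
  ... | true  = cong suc (length-filter-¬ xs)
  ... | false = trans (cong suc (length-filter-¬ xs)) (sym (+-suc _ _))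

  length-filter-filter : ∀ {Q : Pred A 0ℓ} (Q? : Decidable Q) xs →
    length (filter P? (filter Q? xs)) ≤ length (filter P? xs)
  length-filter-filter Q? []       = z≤n
  length-filter-filter Q? (x ∷ xs) with does (Q? x)
  ... | false with does (P? x)
  ...   | true  = m≤n⇒m≤1+n (length-filter-filter Q? xs)
  ...   | false = length-filter-filter Q? xs
  length-filter-filter Q? (x ∷ xs) | true with does (P? x)
  ...   | true  = s≤s (length-filter-filter Q? xs)
  ...   | false = length-filter-filter Q? xs

-- The fiber over the first y is removed before the recursion, so fibers may overlap. This one count
-- serves injections (all weights 1), orbits (weights are formula sizes) and the layers of the
-- torsion of H.
length-fibers : ∀ {A B : Set} {R : A → B → Set} (R? : ∀ x y → Dec (R x y)) (c : ℕ) (g : B → ℕ) xs ys →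
  (∀ {x} → x ∈ˡ xs → Any (R x) ys) →
  (∀ {y} → y ∈ˡ ys → length (filter (λ x → R? x y) xs) * c ≤ g y) →
  length xs * c ≤ sum (map g ys)
length-fibers R? c g []       []       hit bound = z≤n
length-fibers R? c g (x ∷ xs) []       hit bound with () ← hit (here refl)
length-fibers {R = R} R? c g xs (y ∷ ys) hit bound = begin
  length xs * c                                     ≡⟨ cong (_* c) (length-filter-¬ (λ x → R? x y) xs) ⟩
  (length (filter (λ x → R? x y) xs) + length rest) * c ≡⟨ *-distribʳ-+ c (length (filter (λ x → R? x y) xs)) (length rest) ⟩
  length (filter (λ x → R? x y) xs) * c + length rest * c ≤⟨ +-mono-≤ (bound (here refl)) (length-fibers R? c g rest ys hit′ bound′) ⟩
  g y + sum (map g ys)                              ∎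
  where
  open ≤-Reasoning
  rest = filter (λ x → ¬? (R? x y)) xs
  hit′ : ∀ {x} → x ∈ˡ rest → Any (R x) ys
  hit′ x∈ with x∈xs , ¬r ← ∈-filter⁻ (λ x → ¬? (R? x y)) {xs = xs} x∈ | hit x∈xs
  ... | here r   = contradiction r ¬r
  ... | there rs = rs
  bound′ : ∀ {z} → z ∈ˡ ys → length (filter (λ x → R? x z) rest) * c ≤ g z
  bound′ {z} z∈ = ≤-trans (*-monoˡ-≤ c (length-filter-filter (λ x → R? x z) (λ x → ¬? (R? x y)) xs)) (bound (there z∈))

sum-map-const : ∀ {A : Set} c (xs : List A) → sum (map (λ _ → c) xs) ≡ length xs * c
sum-map-const c []       = refl
sum-map-const c (x ∷ xs) = cong (c +_) (sum-map-const c xs)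

sum-map-* : ∀ {A : Set} (f : A → ℕ) c xs → sum (map (λ x → f x * c) xs) ≡ sum (map f xs) * c
sum-map-* f c []       = refl
sum-map-* f c (x ∷ xs) = trans (cong (f x * c +_) (sum-map-* f c xs)) (sym (*-distribʳ-+ c (f x) _))

sum-map-allFin : ∀ {n} (g : Vector ℕ n) → sum (map g (allFin n)) ≡ Functional.foldr _+_ 0 g
sum-map-allFin g = trans (cong sum (map-tabulate (λ i → i) g)) (sum-tabulate g)
  where
  sum-tabulate : ∀ {n} (g : Vector ℕ n) → sum (tabulate g) ≡ Functional.foldr _+_ 0 g
  sum-tabulate {zero}  g = refl
  sum-tabulate {suc n} g = cong (g zero +_) (sum-tabulate (λ i → g (suc i)))

module _ {A B : Set} (_≟_ : DecidableEquality B) (f : A → B) where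

  length-injection : ∀ {xs ys} → Unique xs →
    (∀ {x y} → x ∈ˡ xs → y ∈ˡ xs → f x ≡ f y → x ≡ y) →
    (∀ {x} → x ∈ˡ xs → f x ∈ˡ ys) →
    length xs ≤ length ys
  length-injection {xs} {ys} unique injective maps = begin
    length xs                  ≡⟨ *-identityʳ (length xs) ⟨
    length xs * 1              ≤⟨ length-fibers (λ x y → f x ≟ y) 1 (λ _ → 1) xs ys maps (λ {y} _ → fiber y) ⟩
    sum (map (λ _ → 1) ys)     ≡⟨ sum-map-const 1 ys ⟩
    length ys * 1              ≡⟨ *-identityʳ (length ys) ⟩
    length ys                  ∎
    where
    open ≤-Reasoning
    atMostOne : ∀ {zs : List A} → Unique zs → (∀ {x y} → x ∈ˡ zs → y ∈ˡ zs → x ≡ y) → length zs * 1 ≤ 1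
    atMostOne []      eq = z≤n
    atMostOne ([] ∷ _) eq = ≤-refl
    atMostOne ((x≢y ∷ _) ∷ _) eq = contradiction (eq (here refl) (there (here refl))) x≢y
    fiber : ∀ y → length (filter (λ x → f x ≟ y) xs) * 1 ≤ 1
    fiber y = atMostOne (Unique.filter⁺ (λ x → f x ≟ y) unique) λ u∈ v∈ →
      let u∈xs , fu≡y = ∈-filter⁻ (λ x → f x ≟ y) {xs = xs} u∈
          v∈xs , fv≡y = ∈-filter⁻ (λ x → f x ≟ y) {xs = xs} v∈
      in injective u∈xs v∈xs (trans fu≡y (sym fv≡y))

-- Translating a part of a coset by one of its own points moves it into the subgroup.
length-coset : ∀ {A : Set} (_≟_ : DecidableEquality A) (_-_ : A → A → A) →
  (∀ {x y z} → x - z ≡ y - z → x ≡ y) → ∀ {xs ys} → Unique xs →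
  (∀ {x y} → x ∈ˡ xs → y ∈ˡ xs → (x - y) ∈ˡ ys) → length xs ≤ length ys
length-coset _≟_ _-_ cancel {[]}     unique closed = z≤n
length-coset _≟_ _-_ cancel {z ∷ zs} unique closed =
  length-injection _≟_ (_- z) unique (λ _ _ → cancel) (λ x∈ → closed x∈ (here refl))

length-cartesianProductWith : ∀ {A B C : Set} (f : A → B → C) xs ys →
  length (cartesianProductWith f xs ys) ≡ length xs * length ys
length-cartesianProductWith f []       ys = refl
length-cartesianProductWith f (x ∷ xs) ys =
  trans (length-++ (map (f x) ys)) (cong₂ _+_ (length-map (f x) ys) (length-cartesianProductWith f xs ys))

length-allVecs : ∀ n k → length (allVecs n k) ≡ n ^ k
length-allVecs n zero    = refl
length-allVecs n (suc k) = trans (length-cartesianProductWith _∷_ (allFin n) (allVecs n k))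
  (cong₂ _*_ (length-tabulate {n = n} (λ i → i)) (length-allVecs n k))

allVecs-unique : ∀ n k → Unique (allVecs n k)
allVecs-unique n zero    = [] ∷ []
allVecs-unique n (suc k) =
  Unique.cartesianProductWith⁺ _∷_ Vec.∷-injective (Unique.allFin⁺ n) (allVecs-unique n k)

∈-allVecs : ∀ {n k} (x : Vec (Fin n) k) → x ∈ˡ allVecs n k
∈-allVecs []      = here refl
∈-allVecs (a ∷ x) = ∈-cartesianProductWith⁺ _∷_ (∈-allFin a) (∈-allVecs x)

infix 4 _≟ᵛ_

_≟ᵛ_ : ∀ {n k} → DecidableEquality (Vec (Fin n) k)
_≟ᵛ_ = Vec.≡-dec Fin._≟_

elements : ∀ {n k} {P : Pred (Vec (Fin n) k) 0ℓ} → Decidable P → List (Vec (Fin n) k)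
elements {n} {k} P? = filter P? (allVecs n k)

-- For a subgroup `H`, both `∣ H ∣` and `# (Subgroup.member? H)` unfold to the same length, so group
-- orders and counts are interchangeable without proof.
# : ∀ {n k} {P : Pred (Vec (Fin n) k) 0ℓ} → Decidable P → ℕ
# P? = length (elements P?)

module _ {n k} {P : Pred (Vec (Fin n) k) 0ℓ} (P? : Decidable P) where

  ∈-elements⁺ : ∀ {x} → P x → x ∈ˡ elements P?
  ∈-elements⁺ {x} = ∈-filter⁺ P? (∈-allVecs x)

  ∈-elements⁻ : ∀ {x} → x ∈ˡ elements P? → P x
  ∈-elements⁻ x∈ = proj₂ (∈-filter⁻ P? {xs = allVecs n k} x∈)

  elements-unique : Unique (elements P?)
  elements-unique = Unique.filter⁺ P? (allVecs-unique n k)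

  #-positive : ∀ {x} → P x → 1 ≤ # P?
  #-positive px with elements P? | ∈-elements⁺ px
  ... | _ ∷ _ | _ = s≤s z≤n

module _ {n k} {P Q : Pred (Vec (Fin n) k) 0ℓ} (P? : Decidable P) (Q? : Decidable Q) where

  #-mono : (∀ {x} → P x → Q x) → # P? ≤ # Q?
  #-mono P⊆Q = length-injection _≟ᵛ_ (λ x → x) (elements-unique P?) (λ _ _ eq → eq)
    (λ x∈ → ∈-elements⁺ Q? (P⊆Q (∈-elements⁻ P? x∈)))

  #-reflects-⊇ : (∀ {x} → P x → Q x) → # Q? ≤ # P? → ∀ {x} → Q x → P x
  #-reflects-⊇ P⊆Q Q≤P {x} qx with P? x
  ... | yes px = px
  -- Put in front of the elements of `P`, the missing point x gives a list without repetitions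
  -- inside `Q`, hence a strict inequality.
  ... | no ¬px = contradiction Q≤P (<⇒≱ (length-injection _≟ᵛ_ (λ y → y)
    {xs = x ∷ elements P?} {ys = elements Q?}
    (All.tabulate (λ y∈ x≡y → ¬px (subst P (sym x≡y) (∈-elements⁻ P? y∈))) ∷ elements-unique P?)
    (λ _ _ eq → eq)
    (λ { (here refl) → ∈-elements⁺ Q? qx ; (there y∈) → ∈-elements⁺ Q? (P⊆Q (∈-elements⁻ P? y∈)) })))

-- Vectors over ℤ/n

module _ {n : ℕ} .{{_ : NonZero n}} where

  toℕ-mod-id : ∀ (a : Fin n) → toℕ a mod n ≡ a
  toℕ-mod-id a = Fin.toℕ-injective (trans (toℕ-mod (toℕ a) n) (m<n⇒m%n≡m (Fin.toℕ<n a)))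

  mod-⊗ : ∀ a b → (a mod n) ⊗ (b mod n) ≡ (a * b) mod n
  mod-⊗ a b = mod-cong n (trans
    (cong (_% n) (cong₂ _*_ (toℕ-mod a n) (toℕ-mod b n)))
    (sym (%-distribˡ-* a b n)))

  mod-⊗ʳ : ∀ m (a : Fin n) → (m mod n) ⊗ a ≡ (m * toℕ a) mod n
  mod-⊗ʳ m a = trans (cong ((m mod n) ⊗_) (sym (toℕ-mod-id a))) (mod-⊗ m (toℕ a))

  n*-mod : ∀ m → (m * n) mod n ≡ 0#
  n*-mod m = mod-cong n (trans (m*n%n≡0 m n) (sym (m<n⇒m%n≡m (>-nonZero⁻¹ n))))

  1# : Fin n
  1# = 1 mod n

  ⊕-comm : ∀ (a b : Fin n) → a ⊕ b ≡ b ⊕ a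
  ⊕-comm a b = cong (_mod n) (+-comm (toℕ a) (toℕ b))

  ⊕-assoc : ∀ (a b c : Fin n) → (a ⊕ b) ⊕ c ≡ a ⊕ (b ⊕ c)
  ⊕-assoc a b c = begin
    (a ⊕ b) ⊕ c                               ≡⟨ cong ((a ⊕ b) ⊕_) (toℕ-mod-id c) ⟨
    (a ⊕ b) ⊕ (toℕ c mod n)                   ≡⟨ mod-⊕ (toℕ a + toℕ b) (toℕ c) n ⟩
    (toℕ a + toℕ b + toℕ c) mod n             ≡⟨ cong (_mod n) (+-assoc (toℕ a) (toℕ b) (toℕ c)) ⟩
    (toℕ a + (toℕ b + toℕ c)) mod n           ≡⟨ mod-⊕ (toℕ a) (toℕ b + toℕ c) n ⟨
    (toℕ a mod n) ⊕ (b ⊕ c)                   ≡⟨ cong (_⊕ (b ⊕ c)) (toℕ-mod-id a) ⟩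
    a ⊕ (b ⊕ c)                               ∎
    where open ≡-Reasoning

  ⊕-identityˡ : ∀ (a : Fin n) → 0# ⊕ a ≡ a
  ⊕-identityˡ a = trans (cong (0# ⊕_) (sym (toℕ-mod-id a))) (trans (mod-⊕ 0 (toℕ a) n) (toℕ-mod-id a))

  ⊖-inverseˡ : ∀ (a : Fin n) → (⊖ a) ⊕ a ≡ 0#
  ⊖-inverseˡ a = begin
    (⊖ a) ⊕ a                     ≡⟨ cong ((⊖ a) ⊕_) (toℕ-mod-id a) ⟨
    (⊖ a) ⊕ (toℕ a mod n)         ≡⟨ mod-⊕ (n ∸ toℕ a) (toℕ a) n ⟩
    (n ∸ toℕ a + toℕ a) mod n     ≡⟨ cong (_mod n) (m∸n+n≡m (<⇒≤ (Fin.toℕ<n a))) ⟩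
    n mod n                       ≡⟨ cong (_mod n) (*-identityˡ n) ⟨
    (1 * n) mod n                 ≡⟨ n*-mod 1 ⟩
    0#                            ∎
    where open ≡-Reasoning

  ⊗-comm : ∀ (a b : Fin n) → a ⊗ b ≡ b ⊗ a
  ⊗-comm a b = cong (_mod n) (*-comm (toℕ a) (toℕ b))

  ⊗-assoc : ∀ (a b c : Fin n) → (a ⊗ b) ⊗ c ≡ a ⊗ (b ⊗ c)
  ⊗-assoc a b c = begin
    (a ⊗ b) ⊗ c                               ≡⟨ mod-⊗ʳ (toℕ a * toℕ b) c ⟩
    (toℕ a * toℕ b * toℕ c) mod n             ≡⟨ cong (_mod n) (*-assoc (toℕ a) (toℕ b) (toℕ c)) ⟩
    (toℕ a * (toℕ b * toℕ c)) mod n           ≡⟨ mod-⊗ (toℕ a) (toℕ b * toℕ c) ⟨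
    (toℕ a mod n) ⊗ (b ⊗ c)                   ≡⟨ cong (_⊗ (b ⊗ c)) (toℕ-mod-id a) ⟩
    a ⊗ (b ⊗ c)                               ∎
    where open ≡-Reasoning

  ⊗-identityˡ : ∀ (a : Fin n) → 1# ⊗ a ≡ a
  ⊗-identityˡ a = trans (mod-⊗ʳ 1 a) (trans (cong (_mod n) (*-identityˡ (toℕ a))) (toℕ-mod-id a))

  ⊗-distribˡ-⊕ : ∀ (a b c : Fin n) → a ⊗ (b ⊕ c) ≡ (a ⊗ b) ⊕ (a ⊗ c)
  ⊗-distribˡ-⊕ a b c = begin
    a ⊗ (b ⊕ c)                               ≡⟨ cong (_⊗ (b ⊕ c)) (toℕ-mod-id a) ⟨
    (toℕ a mod n) ⊗ (b ⊕ c)                   ≡⟨ mod-⊗ (toℕ a) (toℕ b + toℕ c) ⟩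
    (toℕ a * (toℕ b + toℕ c)) mod n           ≡⟨ cong (_mod n) (*-distribˡ-+ (toℕ a) (toℕ b) (toℕ c)) ⟩
    (toℕ a * toℕ b + toℕ a * toℕ c) mod n     ≡⟨ mod-⊕ (toℕ a * toℕ b) (toℕ a * toℕ c) n ⟨
    (a ⊗ b) ⊕ (a ⊗ c)                         ∎
    where open ≡-Reasoning

  modularRing : CommutativeRing 0ℓ 0ℓ
  modularRing = record
    { Carrier = Fin n ; _≈_ = _≡_ ; _+_ = _⊕_ ; _*_ = _⊗_ ; -_ = ⊖_ ; 0# = 0# ; 1# = 1#
    ; isCommutativeRing = record
      { isRing = record
        { +-isAbelianGroup = record
          { isGroup = record
            { isMonoid = record
              { isSemigroup = record
                { isMagma = record { isEquivalence = isEquivalence ; ∙-cong = cong₂ _⊕_ }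
                ; assoc = ⊕-assoc }
              ; identity = ⊕-identityˡ , λ a → trans (⊕-comm a 0#) (⊕-identityˡ a) }
            ; inverse = ⊖-inverseˡ , λ a → trans (⊕-comm a (⊖ a)) (⊖-inverseˡ a)
            ; ⁻¹-cong = cong ⊖_ }
          ; comm = ⊕-comm }
        ; *-cong = cong₂ _⊗_
        ; *-assoc = ⊗-assoc
        ; *-identity = ⊗-identityˡ , λ a → trans (⊗-comm a 1#) (⊗-identityˡ a)
        ; distrib = ⊗-distribˡ-⊕ , λ a b c → trans (⊗-comm (b ⊕ c) a)
            (trans (⊗-distribˡ-⊕ a b c) (cong₂ _⊕_ (⊗-comm a b) (⊗-comm a c))) }
      ; *-comm = ⊗-comm } }

  open CommutativeRing modularRing public
    using () renaming (+-identityʳ to ⊕-identityʳ; -‿inverseʳ to ⊖-inverseʳ; distribʳ to ⊗-distribʳ-⊕; zeroˡ to ⊗-zeroˡ; zeroʳ to ⊗-zeroʳ; *-identityʳ to ⊗-identityʳ)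

  vectorGroup : ℕ → AbelianGroup 0ℓ 0ℓ
  vectorGroup k = record
    { Carrier = Vec (Fin n) k ; _≈_ = _≡_ ; _∙_ = _⊕ᵛ_ ; ε = 0ᵛ ; _⁻¹ = ⊖ᵛ_
    ; isAbelianGroup = record
      { isGroup = record
        { isMonoid = record
          { isSemigroup = record
            { isMagma = record { isEquivalence = isEquivalence ; ∙-cong = cong₂ _⊕ᵛ_ }
            ; assoc = Vec.zipWith-assoc ⊕-assoc }
          ; identity = Vec.zipWith-identityˡ ⊕-identityˡ , Vec.zipWith-identityʳ ⊕-identityʳ }
        ; inverse = Vec.zipWith-inverseˡ ⊖-inverseˡ , Vec.zipWith-inverseʳ ⊖-inverseʳ
        ; ⁻¹-cong = cong ⊖ᵛ_ }
      ; comm = Vec.zipWith-comm ⊕-comm } }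

  module ⊕ where
    open GroupProperties (CommutativeRing.+-group modularRing) public
    open CommutativeSemigroupProperties (CommutativeRing.+-commutativeSemigroup modularRing) public using (interchange)

  module ⊕ᵛ {k : ℕ} where
    open AbelianGroup (vectorGroup k) public using (assoc; comm; identityˡ; identityʳ; inverseˡ; inverseʳ)
    open GroupProperties (AbelianGroup.group (vectorGroup k)) public
    open CommutativeSemigroupProperties (AbelianGroup.commutativeSemigroup (vectorGroup k)) public using (interchange)

  ⊗ᵛ-distribˡ-⊕ᵛ : ∀ {k} c (x y : Vec (Fin n) k) → c ⊗ᵛ (x ⊕ᵛ y) ≡ c ⊗ᵛ x ⊕ᵛ c ⊗ᵛ y
  ⊗ᵛ-distribˡ-⊕ᵛ c []      []      = refl
  ⊗ᵛ-distribˡ-⊕ᵛ c (a ∷ x) (b ∷ y) = cong₂ _∷_ (⊗-distribˡ-⊕ c a b) (⊗ᵛ-distribˡ-⊕ᵛ c x y)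

  ⊗ᵛ-distribʳ-⊕ : ∀ {k} (x : Vec (Fin n) k) c d → (c ⊕ d) ⊗ᵛ x ≡ c ⊗ᵛ x ⊕ᵛ d ⊗ᵛ x
  ⊗ᵛ-distribʳ-⊕ []      c d = refl
  ⊗ᵛ-distribʳ-⊕ (a ∷ x) c d = cong₂ _∷_ (⊗-distribʳ-⊕ a c d) (⊗ᵛ-distribʳ-⊕ x c d)

  ⊗ᵛ-zeroˡ : ∀ {k} (x : Vec (Fin n) k) → 0# ⊗ᵛ x ≡ 0ᵛ
  ⊗ᵛ-zeroˡ []      = refl
  ⊗ᵛ-zeroˡ (a ∷ x) = cong₂ _∷_ (⊗-zeroˡ a) (⊗ᵛ-zeroˡ x)

  ⊗ᵛ-identityˡ : ∀ {k} (x : Vec (Fin n) k) → 1# ⊗ᵛ x ≡ x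
  ⊗ᵛ-identityˡ []      = refl
  ⊗ᵛ-identityˡ (a ∷ x) = cong₂ _∷_ (⊗-identityˡ a) (⊗ᵛ-identityˡ x)

  dot-comm : ∀ {k} (x y : Vec (Fin n) k) → dot x y ≡ dot y x
  dot-comm []      []      = refl
  dot-comm (a ∷ x) (b ∷ y) = cong₂ _⊕_ (⊗-comm a b) (dot-comm x y)

  dot-⊕ˡ : ∀ {k} (x y u : Vec (Fin n) k) → dot (x ⊕ᵛ y) u ≡ dot x u ⊕ dot y u
  dot-⊕ˡ []      []      []      = sym (⊕-identityˡ 0#)
  dot-⊕ˡ (a ∷ x) (b ∷ y) (c ∷ u) =
    trans (cong₂ _⊕_ (⊗-distribʳ-⊕ c a b) (dot-⊕ˡ x y u)) (⊕.interchange (a ⊗ c) (b ⊗ c) (dot x u) (dot y u))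

  dot-⊗ˡ : ∀ {k} c (x u : Vec (Fin n) k) → dot (c ⊗ᵛ x) u ≡ c ⊗ dot x u
  dot-⊗ˡ c []      []      = sym (⊗-zeroʳ c)
  dot-⊗ˡ c (a ∷ x) (b ∷ u) =
    trans (cong₂ _⊕_ (⊗-assoc c a b) (dot-⊗ˡ c x u)) (sym (⊗-distribˡ-⊕ c (a ⊗ b) (dot x u)))

  dot-⊕ʳ : ∀ {k} (x u v : Vec (Fin n) k) → dot x (u ⊕ᵛ v) ≡ dot x u ⊕ dot x v
  dot-⊕ʳ x u v = trans (dot-comm x (u ⊕ᵛ v)) (trans (dot-⊕ˡ u v x) (cong₂ _⊕_ (dot-comm u x) (dot-comm v x)))

  dot-⊗ʳ : ∀ {k} c (x u : Vec (Fin n) k) → dot x (c ⊗ᵛ u) ≡ c ⊗ dot x u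
  dot-⊗ʳ c x u = trans (dot-comm x (c ⊗ᵛ u)) (trans (dot-⊗ˡ c u x) (cong (c ⊗_) (dot-comm u x)))

  dot-zeroˡ : ∀ {k} (u : Vec (Fin n) k) → dot 0ᵛ u ≡ 0#
  dot-zeroˡ []      = refl
  dot-zeroˡ (a ∷ u) = trans (cong₂ _⊕_ (⊗-zeroˡ a) (dot-zeroˡ u)) (⊕-identityˡ 0#)

  weight-⊕ : ∀ {k} (x y : Vec (Fin n) k) → weight (x ⊕ᵛ y) ≤ weight x + weight y
  weight-⊕ []      []      = z≤n
  weight-⊕ (a ∷ x) (b ∷ y) with (a ⊕ b) Fin.≟ 0# | a Fin.≟ 0# | b Fin.≟ 0#
  ... | yes _    | yes _    | yes _    = weight-⊕ x y
  ... | yes _    | no _     | yes _    = m≤n⇒m≤1+n (weight-⊕ x y)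
  ... | yes _    | yes _    | no _     = ≤-trans (weight-⊕ x y) (+-monoʳ-≤ (weight x) (n≤1+n _))
  ... | yes _    | no _     | no _     = m≤n⇒m≤1+n (≤-trans (weight-⊕ x y) (+-monoʳ-≤ (weight x) (n≤1+n _)))
  ... | no _     | no _     | yes _    = s≤s (weight-⊕ x y)
  ... | no _     | no _     | no _     = s≤s (≤-trans (weight-⊕ x y) (+-monoʳ-≤ (weight x) (n≤1+n _)))
  ... | no _     | yes _    | no _     = ≤-trans (s≤s (weight-⊕ x y)) (≤-reflexive (sym (+-suc (weight x) (weight y))))
  ... | no a⊕b≢0 | yes refl | yes refl = contradiction (⊕-identityˡ 0#) a⊕b≢0

  weight-⊗ : ∀ {k} c (x : Vec (Fin n) k) → weight (c ⊗ᵛ x) ≤ weight x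
  weight-⊗ c []      = z≤n
  weight-⊗ c (a ∷ x) with (c ⊗ a) Fin.≟ 0# | a Fin.≟ 0#
  ... | yes _   | yes _    = weight-⊗ c x
  ... | yes _   | no _     = m≤n⇒m≤1+n (weight-⊗ c x)
  ... | no _    | no _     = s≤s (weight-⊗ c x)
  ... | no ca≢0 | yes refl = contradiction (⊗-zeroʳ c) ca≢0

  unit : ∀ {k} → Fin k → Vec (Fin n) k
  unit zero    = 1# ∷ 0ᵛ
  unit (suc i) = 0# ∷ unit i

  dot-unit : ∀ {k} (x : Vec (Fin n) k) i → dot x (unit i) ≡ lookup x i
  dot-unit (a ∷ x) zero    = trans (cong₂ _⊕_ (⊗-identityʳ a) (trans (dot-comm x 0ᵛ) (dot-zeroˡ x))) (⊕-identityʳ a)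
  dot-unit (a ∷ x) (suc i) = trans (cong₂ _⊕_ (⊗-zeroʳ a) (dot-unit x i)) (⊕-identityˡ (lookup x i))

  weight-0 : ∀ k → weight (0ᵛ {k = k}) ≡ 0
  weight-0 zero    = refl
  weight-0 (suc k) with 0# {n} Fin.≟ 0#
  ... | yes _  = weight-0 k
  ... | no 0≢0 = contradiction refl 0≢0

  weight-unit : ∀ {k} (i : Fin k) → weight (unit i) ≤ 1
  weight-unit {suc k} zero with 1# Fin.≟ 0# {n}
  ... | yes _ = ≤-trans (≤-reflexive (weight-0 k)) z≤n
  ... | no _  = s≤s (≤-reflexive (weight-0 k))
  weight-unit (suc i) with 0# {n} Fin.≟ 0#
  ... | yes _  = weight-unit i
  ... | no 0≢0 = contradiction refl 0≢0

-- Subspaces and their annihilators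

module _ {p k : ℕ} .{{_ : NonZero p}} where

  open Subspace using (Member)

  infixl 8 _∩ker_

  _∩ker_ : Subspace p k → Vec (Fin p) k → Subspace p k
  V ∩ker u = record
    { Member   = λ x → x ∈ Member V × dot x u ≡ 0#
    ; 0∈       = V.0∈ , dot-zeroˡ u
    ; ⊕-closed = λ {x} {y} (x∈ , xu≡0) (y∈ , yu≡0) → V.⊕-closed x∈ y∈ ,
        trans (dot-⊕ˡ x y u) (trans (cong₂ _⊕_ xu≡0 yu≡0) (⊕-identityˡ 0#))
    ; ⊗-closed = λ c {x} (x∈ , xu≡0) → V.⊗-closed c x∈ ,
        trans (dot-⊗ˡ c x u) (trans (cong (c ⊗_) xu≡0) (⊗-zeroʳ c))
    }
    where module V = Subspace V

  ∩ker? : ∀ {V : Subspace p k} → Decidable (Member V) → ∀ u → Decidable (Member (V ∩ker u))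
  ∩ker? V? u x = V? x ×-dec (dot x u Fin.≟ 0#)

  -- A search through the finitely many elements turns failure to annihilate into an explicit y, the
  -- direction along which a space is cut or extended.
  annihilates? : ∀ {V : Subspace p k} → Decidable (Member V) → ∀ u →
    (u ∈ V ^⊥) ⊎ ∃[ y ] y ∈ Member V × dot y u ≢ 0#
  annihilates? {V} V? u with All.all? (λ x → dot x u Fin.≟ 0#) (elements V?)
  ... | yes all = inj₁ λ x x∈ → All.lookup all (∈-elements⁺ V? x∈)
  ... | no ¬all with y , y∈ , yu≢0 ← find (¬All⇒Any¬ (λ x → dot x u Fin.≟ 0#) (elements V?) ¬all) =
    inj₂ (y , ∈-elements⁻ V? y∈ , yu≢0)

  annihilator? : ∀ {V : Subspace p k} → Decidable (Member V) → Decidable (V ^⊥)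
  annihilator? {V} V? u with annihilates? {V} V? u
  ... | inj₁ u∈⊥              = yes u∈⊥
  ... | inj₂ (y , y∈ , yu≢0)  = no λ u∈⊥ → yu≢0 (u∈⊥ y y∈)

  -- For u in V^⊥, `dot v u ≢ 0#` says that u lies outside (V + ⟨v⟩)^⊥, so this u attains μ(V, V +
  -- ⟨v⟩). The functional φ₀ shows that there is a candidate and is the default of `argmin`.
  lightest : ∀ {V : Subspace p k} (V? : Decidable (Member V)) {v φ₀} → φ₀ ∈ V ^⊥ → dot v φ₀ ≢ 0# →
    ∃[ u ] u ∈ V ^⊥ × dot v u ≢ 0# × (∀ u′ → u′ ∈ V ^⊥ → dot v u′ ≢ 0# → weight u ≤ weight u′)
  lightest {V} V? {v} {φ₀} φ₀∈ vφ₀≢0 = u , proj₁ Pu , proj₂ Pu ,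
    λ u′ u′∈ vu′≢0 → All.lookup (f[argmin]≤f[xs] φ₀ (elements P?)) (∈-elements⁺ P? (u′∈ , vu′≢0))
    where
    P : Pred (Vec (Fin p) k) 0ℓ
    P u = u ∈ V ^⊥ × dot v u ≢ 0#
    P? : Decidable P
    P? u = annihilator? {V} V? u ×-dec ¬? (dot v u Fin.≟ 0#)
    u = argmin weight φ₀ (elements P?)
    Pu : P u
    Pu = argmin-all weight {xs = elements P?} (φ₀∈ , vφ₀≢0) (All.tabulate (∈-elements⁻ P?))

  -- To be used with V = V_H and V′ = V_K. The number m is a lower bound for μ(V′, V′ + ⟨v + y⟩),
  -- and φ witnesses μ(V, V + ⟨v⟩) ≤ (i + 1)m. The functional itself is recorded, not only its
  -- weight, so that the recursion can correct it by a further one.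
  record Descent (V V′ : Subspace p k) (V′? : Decidable (Member V′)) (r : ℕ) (v : Vec (Fin p) k) : Set where
    field
      i r′    : ℕ
      i+r′≡r  : i + r′ ≡ r
      #V′≤    : # V′? ≤ p ^ r′
      y       : Vec (Fin p) k
      y∈      : y ∈ Member V
      m       : ℕ
      minimal : ∀ u → u ∈ V′ ^⊥ → dot (v ⊕ᵛ y) u ≢ 0# → m ≤ weight u
      φ       : Vec (Fin p) k
      φ∈      : φ ∈ V ^⊥
      vφ≢0    : dot v φ ≢ 0#
      weight≤ : weight φ ≤ suc i * m

-- Inverses modulo a prime, and the descent

module _ {p : ℕ} .{{_ : NonZero p}} (isPrime : Prime p) where

  -- Bézout's identity for p and a reads 1 + ya = xp or 1 + xp = ya, and the second form needs a
  -- change of sign. The negative of the inverse is what elimination asks for.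
  negatedInverse : ∀ {a : Fin p} → a ≢ 0# → ∃[ b ] 1# ⊕ b ⊗ a ≡ 0#
  negatedInverse {a} a≢0 with coprime-Bézout (prime⇒coprime isPrime {{≢-nonZero a≢0′}} (Fin.toℕ<n a))
    where
    a≢0′ : toℕ a ≢ 0
    a≢0′ eq = a≢0 (trans (sym (toℕ-mod-id a)) (cong (_mod p) eq))
  ... | Bézout.+- x y eq = y mod p , (begin
    1# ⊕ (y mod p) ⊗ a              ≡⟨ cong (1# ⊕_) (mod-⊗ʳ y a) ⟩
    1# ⊕ ((y * toℕ a) mod p)        ≡⟨ mod-⊕ 1 (y * toℕ a) p ⟩
    (1 + y * toℕ a) mod p           ≡⟨ cong (_mod p) eq ⟩
    (x * p) mod p                   ≡⟨ n*-mod x ⟩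
    0#                              ∎)
    where open ≡-Reasoning
  ... | Bézout.-+ x y eq = ⊖ (y mod p) , (begin
    1# ⊕ (⊖ (y mod p)) ⊗ a          ≡⟨ cong (1# ⊕_) (-‿distribˡ-* (y mod p) a) ⟨
    1# ⊕ (⊖ ((y mod p) ⊗ a))        ≡⟨ cong (λ z → 1# ⊕ (⊖ z)) (mod-⊗ʳ y a) ⟩
    1# ⊕ (⊖ ((y * toℕ a) mod p))    ≡⟨ cong (λ z → 1# ⊕ (⊖ (z mod p))) eq ⟨
    1# ⊕ (⊖ ((1 + x * p) mod p))    ≡⟨ cong (λ z → 1# ⊕ (⊖ z)) (mod-⊕ 1 (x * p) p) ⟨
    1# ⊕ (⊖ (1# ⊕ ((x * p) mod p))) ≡⟨ cong (λ z → 1# ⊕ (⊖ (1# ⊕ z))) (n*-mod x) ⟩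
    1# ⊕ (⊖ (1# ⊕ 0#))              ≡⟨ cong (λ z → 1# ⊕ (⊖ z)) (⊕-identityʳ 1#) ⟩
    1# ⊕ (⊖ 1#)                     ≡⟨ ⊖-inverseʳ 1# ⟩
    0#                              ∎)
    where
    open ≡-Reasoning
    open RingProperties (CommutativeRing.ring (modularRing {p})) using (-‿distribˡ-*)

  ⊗-eliminate : ∀ {a : Fin p} → a ≢ 0# → ∀ s → ∃[ c ] s ⊕ c ⊗ a ≡ 0#
  ⊗-eliminate {a} a≢0 s with b , 1+ba≡0 ← negatedInverse a≢0 = s ⊗ b , (begin
    s ⊕ (s ⊗ b) ⊗ a           ≡⟨ cong₂ _⊕_ (sym (⊗-identityʳ s)) (⊗-assoc s b a) ⟩
    s ⊗ 1# ⊕ s ⊗ (b ⊗ a)      ≡⟨ ⊗-distribˡ-⊕ s 1# (b ⊗ a) ⟨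
    s ⊗ (1# ⊕ b ⊗ a)          ≡⟨ cong (s ⊗_) 1+ba≡0 ⟩
    s ⊗ 0#                    ≡⟨ ⊗-zeroʳ s ⟩
    0#                        ∎)
    where open ≡-Reasoning

  ⊗-cancelʳ : ∀ {a : Fin p} → a ≢ 0# → ∀ {c d} → c ⊗ a ≡ d ⊗ a → c ≡ d
  ⊗-cancelʳ {a} a≢0 {c} {d} ca≡da = begin
    c                  ≡⟨ expand c ⟩
    ⊖ (b ⊗ (c ⊗ a))    ≡⟨ cong (λ z → ⊖ (b ⊗ z)) ca≡da ⟩
    ⊖ (b ⊗ (d ⊗ a))    ≡⟨ expand d ⟨
    d                  ∎
    where
    open ≡-Reasoning
    b = proj₁ (negatedInverse a≢0)
    expand : ∀ c → c ≡ ⊖ (b ⊗ (c ⊗ a))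
    expand c = ⊕.inverseˡ-unique c (b ⊗ (c ⊗ a)) (begin
      c ⊕ b ⊗ (c ⊗ a)       ≡⟨ cong₂ _⊕_ (sym (⊗-identityˡ c)) (trans (cong (b ⊗_) (⊗-comm c a)) (sym (⊗-assoc b a c))) ⟩
      1# ⊗ c ⊕ (b ⊗ a) ⊗ c  ≡⟨ ⊗-distribʳ-⊕ c 1# (b ⊗ a) ⟨
      (1# ⊕ b ⊗ a) ⊗ c      ≡⟨ cong (_⊗ c) (proj₂ (negatedInverse a≢0)) ⟩
      0# ⊗ c                ≡⟨ ⊗-zeroˡ c ⟩
      0#                    ∎)

  module _ {k : ℕ} where

    open Subspace using (Member)

    #-∩ker : ∀ {V : Subspace p k} (V? : Decidable (Member V)) {u y} → y ∈ Member V → dot y u ≢ 0# →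
      # (∩ker? {V = V} V? u) * p ≤ # V?
    #-∩ker {V} V? {u} {y} y∈ yu≢0 = begin
      # V₁? * p                      ≡⟨ cong (# V₁? *_) (length-tabulate {n = p} (λ i → i)) ⟨
      # V₁? * length (allFin p)      ≡⟨ length-cartesianProductWith _,_ (elements V₁?) (allFin p) ⟨
      length pairs                   ≤⟨ length-injection _≟ᵛ_ f (Unique.cartesianProduct⁺ (elements-unique V₁?) (Unique.allFin⁺ p)) injective maps ⟩
      # V?                           ∎
      where
      open ≤-Reasoning
      module V = Subspace V
      V₁? = ∩ker? {V = V} V? u
      pairs = cartesianProduct (elements V₁?) (allFin p)
      -- The p translates of the kernel by multiples of y are disjoint parts of V, since the dot
      -- product with u reads off c.
      f : Vec (Fin p) k × Fin p → Vec (Fin p) k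
      f (x , c) = x ⊕ᵛ c ⊗ᵛ y
      V₁∋ : ∀ {z} → z ∈ˡ pairs → proj₁ z ∈ Member (V ∩ker u)
      V₁∋ z∈ = ∈-elements⁻ V₁? (proj₁ (∈-cartesianProduct⁻ (elements V₁?) (allFin p) z∈))
      dot-f : ∀ {x} c → x ∈ Member (V ∩ker u) → dot (f (x , c)) u ≡ c ⊗ dot y u
      dot-f {x} c (_ , xu≡0) = trans (dot-⊕ˡ x (c ⊗ᵛ y) u)
        (trans (cong₂ _⊕_ xu≡0 (dot-⊗ˡ c y u)) (⊕-identityˡ _))
      maps : ∀ {z} → z ∈ˡ pairs → f z ∈ˡ elements V?
      maps {x , c} z∈ = ∈-elements⁺ V? (V.⊕-closed (proj₁ (V₁∋ z∈)) (V.⊗-closed c y∈))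
      injective : ∀ {z z′} → z ∈ˡ pairs → z′ ∈ˡ pairs → f z ≡ f z′ → z ≡ z′
      injective {x , c} {x′ , c′} z∈ z′∈ eq = cong₂ _,_ x≡x′ c≡c′
        where
        c≡c′ : c ≡ c′
        c≡c′ = ⊗-cancelʳ yu≢0 (trans (sym (dot-f c (V₁∋ z∈))) (trans (cong (λ w → dot w u) eq) (dot-f c′ (V₁∋ z′∈))))
        x≡x′ : x ≡ x′
        x≡x′ = ⊕ᵛ.∙-cancelʳ (c ⊗ᵛ y) x x′ (trans eq (cong (λ d → x′ ⊕ᵛ d ⊗ᵛ y) (sym c≡c′)))

    module _ {V′ : Subspace p k} (V′? : Decidable (Member V′)) where

      -- Greedily cut V down by a lightest functional u of V′^⊥ that is nonzero at v, moving v into its kernel,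
      -- until u vanishes on V; a linear combination of the i + 1 functionals used vanishes on the original V.
      descent : ∀ r {V : Subspace p k} (V? : Decidable (Member V)) → (∀ {x} → x ∈ Member V′ → x ∈ Member V) →
        # V? ≤ p ^ r → ∀ {v φ₀} → φ₀ ∈ V ^⊥ → dot v φ₀ ≢ 0# → Descent V V′ V′? r v
      descent r {V} V? V′⊆V #V≤ {v} {φ₀} φ₀∈ vφ₀≢0
        with lightest {V = V′} V′? {v} {φ₀} (λ x x∈ → φ₀∈ x (V′⊆V x∈)) vφ₀≢0
      ... | u , u∈ , vu≢0 , u-min with annihilates? {V = V} V? u
      ... | inj₁ u∈V⊥ = record
        { i = 0 ; r′ = r ; i+r′≡r = refl ; #V′≤ = ≤-trans (#-mono V′? V? V′⊆V) #V≤
        ; y = 0ᵛ ; y∈ = Subspace.0∈ V ; m = weight u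
        ; minimal = λ u′ u′∈ vu′≢0 → u-min u′ u′∈ (subst (λ z → dot z u′ ≢ 0#) (⊕ᵛ.identityʳ v) vu′≢0)
        ; φ = u ; φ∈ = u∈V⊥ ; vφ≢0 = vu≢0 ; weight≤ = ≤-reflexive (sym (*-identityˡ (weight u))) }
      ... | inj₂ (y₀ , y₀∈ , y₀u≢0) = cut r #V≤
        where
        module V = Subspace V
        V₁ = V ∩ker u
        V₁? = ∩ker? {V = V} V? u
        -- This c puts v₁ = v + y into the kernel of u. As u is nonzero at v, it is then nonzero at
        -- y, so V = V₁ + ⟨y⟩.
        c = proj₁ (⊗-eliminate y₀u≢0 (dot v u))
        y = c ⊗ᵛ y₀
        y∈ : y ∈ Member V
        y∈ = V.⊗-closed c y₀∈
        v₁ = v ⊕ᵛ y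
        v₁u≡0 : dot v₁ u ≡ 0#
        v₁u≡0 = trans (dot-⊕ˡ v y u) (trans (cong (dot v u ⊕_) (dot-⊗ˡ c y₀ u)) (proj₂ (⊗-eliminate y₀u≢0 (dot v u))))
        yu≢0 : dot y u ≢ 0#
        yu≢0 yu≡0 = vu≢0 (trans (sym (⊕-identityʳ (dot v u))) (trans (cong (dot v u ⊕_) (sym yu≡0)) (trans (sym (dot-⊕ˡ v y u)) v₁u≡0)))
        #V₁p≤ : # V₁? * p ≤ # V?
        #V₁p≤ = #-∩ker {V} V? {u} {y₀} y₀∈ y₀u≢0
        cut : ∀ r → # V? ≤ p ^ r → Descent V V′ V′? r v
        cut zero    #V≤1 = contradiction (≤-trans #V₁p≤ #V≤1)
          (<⇒≱ (≤-trans (nonTrivial⇒n>1 p {{prime⇒nonTrivial isPrime}}) (m≤n*m p (# V₁?) {{>-nonZero (#-positive V₁? {x = 0ᵛ} (Subspace.0∈ V₁))}})))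
        -- The new m is the larger of `weight u` and m₁: as φ weighs at most (i₁ + 1)m₁ + weight u,
        -- the factor i₁ + 2 suffices for either. If it is m₁, the direction found by the recursion
        -- is kept; if it is `weight u`, the direction returns to v itself, for which u was
        -- lightest.
        cut (suc r) #V≤ = result (≤-total (weight u) m₁)
          where
          #V₁≤ : # V₁? ≤ p ^ r
          #V₁≤ = *-cancelʳ-≤ _ _ p (≤-trans #V₁p≤ (≤-trans #V≤ (≤-reflexive (*-comm p (p ^ r)))))
          v₁φ₀≡ : dot v₁ φ₀ ≡ dot v φ₀
          v₁φ₀≡ = trans (dot-⊕ˡ v y φ₀) (trans (cong (dot v φ₀ ⊕_) (φ₀∈ y y∈)) (⊕-identityʳ _))
          open Descent (descent r {V₁} V₁? (λ {x} x∈ → V′⊆V x∈ , u∈ x x∈) #V₁≤ {v₁} {φ₀}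
            (λ x (x∈ , _) → φ₀∈ x x∈) (λ eq → vφ₀≢0 (trans (sym v₁φ₀≡) eq)))
            renaming (i to i₁; r′ to r₁; i+r′≡r to i₁+r₁≡r; #V′≤ to #V′≤₁; y to y₁; y∈ to y₁∈; m to m₁
                     ; minimal to minimal₁; φ to φ₁; φ∈ to φ₁∈; vφ≢0 to v₁φ₁≢0; weight≤ to weight≤₁)
          -- Adding a multiple of u leaves φ₁ unchanged on V₁, where it vanishes; this multiple
          -- makes it vanish at y as well, hence on V.
          e = proj₁ (⊗-eliminate yu≢0 (dot y φ₁))
          φ = φ₁ ⊕ᵛ e ⊗ᵛ u
          dot-φ : ∀ x → dot x φ ≡ dot x φ₁ ⊕ e ⊗ dot x u
          dot-φ x = trans (dot-⊕ʳ x φ₁ (e ⊗ᵛ u)) (cong (dot x φ₁ ⊕_) (dot-⊗ʳ e x u))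
          dot-φ-ker : ∀ x → dot x u ≡ 0# → dot x φ ≡ dot x φ₁
          dot-φ-ker x xu≡0 = trans (dot-φ x) (trans (cong (λ z → dot x φ₁ ⊕ e ⊗ z) xu≡0) (trans (cong (dot x φ₁ ⊕_) (⊗-zeroʳ e)) (⊕-identityʳ _)))
          yφ≡0 : dot y φ ≡ 0#
          yφ≡0 = trans (dot-φ y) (proj₂ (⊗-eliminate yu≢0 (dot y φ₁)))
          φ∈ : φ ∈ V ^⊥
          φ∈ x x∈ = begin
            dot x φ                   ≡⟨ ⊕-identityʳ _ ⟨
            dot x φ ⊕ 0#              ≡⟨ cong (dot x φ ⊕_) (trans (cong (g ⊗_) yφ≡0) (⊗-zeroʳ g)) ⟨
            dot x φ ⊕ g ⊗ dot y φ     ≡⟨ dot-z φ ⟨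
            dot z φ                   ≡⟨ dot-φ-ker z zu≡0 ⟩
            dot z φ₁                  ≡⟨ φ₁∈ z (V.⊕-closed x∈ (V.⊗-closed g y∈) , zu≡0) ⟩
            0#                        ∎
            where
            open ≡-Reasoning
            g = proj₁ (⊗-eliminate yu≢0 (dot x u))
            z = x ⊕ᵛ g ⊗ᵛ y
            dot-z : ∀ ψ → dot z ψ ≡ dot x ψ ⊕ g ⊗ dot y ψ
            dot-z ψ = trans (dot-⊕ˡ x (g ⊗ᵛ y) ψ) (cong (dot x ψ ⊕_) (dot-⊗ˡ g y ψ))
            zu≡0 : dot z u ≡ 0#
            zu≡0 = trans (dot-z u) (proj₂ (⊗-eliminate yu≢0 (dot x u)))
          vφ≢0 : dot v φ ≢ 0#
          vφ≢0 vφ≡0 = v₁φ₁≢0 (trans (sym (dot-φ-ker v₁ v₁u≡0))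
            (trans (dot-⊕ˡ v y φ) (trans (cong₂ _⊕_ vφ≡0 yφ≡0) (⊕-identityˡ 0#))))
          weightφ≤ : ∀ {m} → weight u ≤ m → m₁ ≤ m → weight φ ≤ suc (suc i₁) * m
          weightφ≤ {m} u≤m m₁≤m = begin
            weight φ                          ≤⟨ weight-⊕ φ₁ (e ⊗ᵛ u) ⟩
            weight φ₁ + weight (e ⊗ᵛ u)       ≤⟨ +-mono-≤ (≤-trans weight≤₁ (*-monoʳ-≤ (suc i₁) m₁≤m)) (≤-trans (weight-⊗ e u) u≤m) ⟩
            suc i₁ * m + m                    ≡⟨ +-comm (suc i₁ * m) m ⟩
            suc (suc i₁) * m                  ∎
            where open ≤-Reasoning
          result : weight u ≤ m₁ ⊎ m₁ ≤ weight u → Descent V V′ V′? (suc r) v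
          result (inj₁ u≤m₁) = record
            { i = suc i₁ ; r′ = r₁ ; i+r′≡r = cong suc i₁+r₁≡r ; #V′≤ = #V′≤₁
            ; y = y ⊕ᵛ y₁ ; y∈ = V.⊕-closed y∈ (proj₁ y₁∈) ; m = m₁
            ; minimal = λ u′ u′∈ ≢0 → minimal₁ u′ u′∈ (subst (λ z → dot z u′ ≢ 0#) (sym (⊕ᵛ.assoc v y y₁)) ≢0)
            ; φ = φ ; φ∈ = φ∈ ; vφ≢0 = vφ≢0 ; weight≤ = weightφ≤ u≤m₁ ≤-refl }
          result (inj₂ m₁≤u) = record
            { i = suc i₁ ; r′ = r₁ ; i+r′≡r = cong suc i₁+r₁≡r ; #V′≤ = #V′≤₁
            ; y = 0ᵛ ; y∈ = V.0∈ ; m = weight u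
            ; minimal = λ u′ u′∈ ≢0 → u-min u′ u′∈ (subst (λ z → dot z u′ ≢ 0#) (⊕ᵛ.identityʳ v) ≢0)
            ; φ = φ ; φ∈ = φ∈ ; vφ≢0 = vφ≢0 ; weight≤ = weightφ≤ ≤-refl m₁≤u }

-- Formulas and the translation action

private
  module ∑ = CommutativeMonoidSum +-0-commutativeMonoid
  module ⋀ = CommutativeMonoidSum Bool.∧-commutativeMonoid
  module ⋁ = CommutativeMonoidSum Bool.∨-commutativeMonoid

module _ {X : Set} where

  ≅-refl : ∀ (φ : Formula X) → φ ≅ φ
  ≅-refl (const b)  = const b
  ≅-refl (lit l)    = lit l
  ≅-refl (gate g φ) = gate g Perm.id (λ i → ≅-refl (φ i))

  ≅-sym : ∀ {φ ψ : Formula X} → φ ≅ ψ → ψ ≅ φ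
  ≅-sym (const b) = const b
  ≅-sym (lit l)   = lit l
  ≅-sym (gate g {φ = φ} {ψ} π eqs) = gate g (Perm.flip π) λ j →
    subst (λ i → ψ i ≅ φ (π ⟨$⟩ˡ j)) (Perm.inverseʳ π) (≅-sym (eqs (π ⟨$⟩ˡ j)))

  ≅-trans : ∀ {φ ψ χ : Formula X} → φ ≅ ψ → ψ ≅ χ → φ ≅ χ
  ≅-trans (const b)      (const .b)        = const b
  ≅-trans (lit l)        (lit .l)          = lit l
  ≅-trans (gate g π eqs) (gate .g ρ eqs′) = gate g (π Perm.∘ₚ ρ) λ i → ≅-trans (eqs i) (eqs′ (π ⟨$⟩ʳ i))

  relabel-cong : ∀ σ {φ ψ : Formula X} → φ ≅ ψ → relabel σ φ ≅ relabel σ ψ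
  relabel-cong σ (const b)      = const b
  relabel-cong σ (lit l)        = lit (relabelLiteral σ l)
  relabel-cong σ (gate g π eqs) = gate g π λ i → relabel-cong σ (eqs i)

  relabel-∘ : ∀ {σ τ ρ : X → X} → (∀ x → σ (τ x) ≡ ρ x) → ∀ φ → relabel σ (relabel τ φ) ≅ relabel ρ φ
  relabel-∘ eq (const b)     = const b
  relabel-∘ {ρ = ρ} eq (lit (pos x)) = subst (λ y → lit (pos y) ≅ lit (pos (ρ x))) (sym (eq x)) (lit (pos (ρ x)))
  relabel-∘ {ρ = ρ} eq (lit (neg x)) = subst (λ y → lit (neg y) ≅ lit (neg (ρ x))) (sym (eq x)) (lit (neg (ρ x)))
  relabel-∘ eq (gate g φ)    = gate g Perm.id λ i → relabel-∘ eq (φ i)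

  relabel-id : ∀ {σ : X → X} → (∀ x → σ x ≡ x) → ∀ φ → relabel σ φ ≅ φ
  relabel-id eq (const b)     = const b
  relabel-id eq (lit (pos x)) = subst (λ y → lit (pos y) ≅ lit (pos x)) (sym (eq x)) (lit (pos x))
  relabel-id eq (lit (neg x)) = subst (λ y → lit (neg y) ≅ lit (neg x)) (sym (eq x)) (lit (neg x))
  relabel-id eq (gate g φ)    = gate g Perm.id λ i → relabel-id eq (φ i)

  size-≅ : ∀ {φ ψ : Formula X} → φ ≅ ψ → size φ ≡ size ψ
  size-≅ (const b) = refl
  size-≅ (lit l)   = refl
  size-≅ (gate g {ψ = ψ} π eqs) =
    trans (∑.sum-cong-≗ (λ i → size-≅ (eqs i))) (sym (∑.sum-permute (λ j → size (ψ j)) π))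

  size-relabel : ∀ σ (φ : Formula X) → size (relabel σ φ) ≡ size φ
  size-relabel σ (const b)  = refl
  size-relabel σ (lit l)    = refl
  size-relabel σ (gate g φ) = ∑.sum-cong-≗ (λ i → size-relabel σ (φ i))

  eval-≅ : ∀ {φ ψ : Formula X} → φ ≅ ψ → ∀ ρ → eval φ ρ ≡ eval ψ ρ
  eval-≅ (const b) ρ = refl
  eval-≅ (lit l)   ρ = refl
  eval-≅ (gate AND {ψ = ψ} π eqs) ρ =
    trans (⋀.sum-cong-≗ (λ i → eval-≅ (eqs i) ρ)) (sym (⋀.sum-permute (λ j → eval (ψ j) ρ) π))
  eval-≅ (gate OR  {ψ = ψ} π eqs) ρ =
    trans (⋁.sum-cong-≗ (λ i → eval-≅ (eqs i) ρ)) (sym (⋁.sum-permute (λ j → eval (ψ j) ρ) π))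

  eval-relabel : ∀ {σ : X → X} {ρ ρ′ : X → Bool} → (∀ x → ρ (σ x) ≡ ρ′ x) →
    ∀ φ → eval (relabel σ φ) ρ ≡ eval φ ρ′
  eval-relabel eq (const b)     = refl
  eval-relabel eq (lit (pos x)) = eq x
  eval-relabel eq (lit (neg x)) = cong not (eq x)
  eval-relabel {σ} {ρ} {ρ′} eq (gate AND φ)  = ⋀.sum-cong-≗ (λ i → eval-relabel {σ} {ρ} {ρ′} eq (φ i))
  eval-relabel {σ} {ρ} {ρ′} eq (gate OR φ)   = ⋁.sum-cong-≗ (λ i → eval-relabel {σ} {ρ} {ρ′} eq (φ i))

  -- The value that every child of the gate takes when the gate takes it.
  neutral : Gate → Bool
  neutral AND = true
  neutral OR  = false

  private
    ⋀-true⁻ : ∀ {n} (f : Vector Bool n) → Functional.foldr _∧_ true f ≡ true → ∀ i → f i ≡ true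
    ⋀-true⁻ f eq zero    with true ← f zero = refl
    ⋀-true⁻ f eq (suc i) with true ← f zero = ⋀-true⁻ (λ i → f (suc i)) eq i

    ⋁-false⁻ : ∀ {n} (f : Vector Bool n) → Functional.foldr _∨_ false f ≡ false → ∀ i → f i ≡ false
    ⋁-false⁻ f eq zero    with false ← f zero = refl
    ⋁-false⁻ f eq (suc i) with false ← f zero = ⋁-false⁻ (λ i → f (suc i)) eq i

  eval-neutral⁻ : ∀ g {n} (φ : Vector (Formula X) (suc n)) {ρ} →
    eval (gate g φ) ρ ≡ neutral g → ∀ i → eval (φ i) ρ ≡ neutral g
  eval-neutral⁻ AND φ {ρ} = ⋀-true⁻ (λ i → eval (φ i) ρ)
  eval-neutral⁻ OR  φ {ρ} = ⋁-false⁻ (λ i → eval (φ i) ρ)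

  eval-neutral⁺ : ∀ g {n} (φ : Vector (Formula X) (suc n)) {ρ} →
    (∀ i → eval (φ i) ρ ≡ neutral g) → eval (gate g φ) ρ ≡ neutral g
  eval-neutral⁺ AND {n} φ all = trans (⋀.sum-cong-≗ all) (⋀.sum-replicate-zero (suc n))
  eval-neutral⁺ OR  {n} φ all = trans (⋁.sum-cong-≗ all) (⋁.sum-replicate-zero (suc n))

  eval-≢neutral : ∀ g {n} (φ : Vector (Formula X) (suc n)) {ρ} →
    eval (gate g φ) ρ ≢ neutral g → ∃[ i ] eval (φ i) ρ ≢ neutral g
  eval-≢neutral g {n} φ {ρ} ≢neutral =
    Fin.¬∀⟶∃¬ (suc n) _ (λ i → eval (φ i) ρ Bool.≟ neutral g) (λ all → ≢neutral (eval-neutral⁺ g φ all))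

  depth-child : ∀ {n} (φ : Vector (Formula X) n) i → depth (φ i) ≤ Functional.foldr _⊔_ 0 (λ j → depth (φ j))
  depth-child φ zero    = m≤m⊔n _ _
  depth-child φ (suc i) = ≤-trans (depth-child (λ j → φ (suc j)) i) (m≤n⊔m _ _)

  relabel-child : ∀ {σ : X → X} {g m n} {φ : Vector (Formula X) (suc m)} {ψ : Vector (Formula X) (suc n)} →
    relabel σ (gate g φ) ≅ gate g ψ → ∀ i → ∃[ j ] relabel σ (φ i) ≅ ψ j
  relabel-child (gate g π eqs) i = π ⟨$⟩ʳ i , eqs i

module _ {q k : ℕ} .{{_ : NonZero q}} where

  act : Vec (Fin q) k → Formula (Variable q k) → Formula (Variable q k)
  act h = relabel (translate h)

  act-⊕ : ∀ g h φ → act g (act h φ) ≅ act (g ⊕ᵛ h) φ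
  act-⊕ g h = relabel-∘ λ (i , a , b) → cong (λ c → i , c , b)
    (trans (sym (⊕-assoc (lookup g i) (lookup h i) a)) (cong (_⊕ a) (sym (Vec.lookup-zipWith _⊕_ i g h))))

  act-0 : ∀ φ → act 0ᵛ φ ≅ φ
  act-0 = relabel-id λ (i , a , b) → cong (λ c → i , c , b)
    (trans (cong (_⊕ a) (Vec.lookup-replicate i 0#)) (⊕-identityˡ a))

  act-⊖ : ∀ h {φ ψ} → act h φ ≅ ψ → act (⊖ᵛ h) ψ ≅ φ
  act-⊖ h {φ} {ψ} eq = ≅-trans (relabel-cong _ (≅-sym eq)) (≅-trans (act-⊕ (⊖ᵛ h) h φ)
    (subst (λ z → act z φ ≅ φ) (sym (⊕ᵛ.inverseˡ h)) (act-0 φ)))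

  -- Commutativity of the group gives all formulas in an orbit the same stabilizer, so a child may
  -- be exchanged for a translate.
  act-comm : ∀ g h φ → act g (act h φ) ≅ act h (act g φ)
  act-comm g h φ = ≅-trans (act-⊕ g h φ) (subst (λ z → act z φ ≅ act h (act g φ)) (⊕ᵛ.comm h g) (≅-sym (act-⊕ h g φ)))

  point-translate : ∀ h x (v : Variable q k) → point (h ⊕ᵛ x) (translate h v) ≡ point x v
  point-translate h x (i , a , b) = does-⇔ (mk⇔
    (λ eq → ⊕.∙-cancelˡ (lookup h i) a _ (trans eq shift))
    (λ eq → trans (cong (lookup h i ⊕_) eq) (sym shift)))
    ((lookup h i ⊕ a) Fin.≟ (lookup (h ⊕ᵛ x) i ⊕ b)) (a Fin.≟ (lookup x i ⊕ b))
    where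
    shift : lookup (h ⊕ᵛ x) i ⊕ b ≡ lookup h i ⊕ (lookup x i ⊕ b)
    shift = trans (cong (_⊕ b) (Vec.lookup-zipWith _⊕_ i h x)) (⊕-assoc (lookup h i) (lookup x i) b)

  eval-act : ∀ h x φ → eval (act h φ) (point (h ⊕ᵛ x)) ≡ eval φ (point x)
  eval-act h x = eval-relabel (point-translate h x)

  eval-invariant : ∀ (H : Subgroup q k) {φ} → Invariant H φ → ∀ {h} → h ∈ Subgroup.Member H → ∀ x →
    eval φ (point (h ⊕ᵛ x)) ≡ eval φ (point x)
  eval-invariant H {φ} inv {h} h∈ x = trans (sym (eval-≅ (inv h h∈) (point (h ⊕ᵛ x)))) (eval-act h x φ)

  module _ (H : Subgroup q k) (ψ : Formula (Variable q k)) (fixes? : Decidable (λ h → act h ψ ≅ ψ)) where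

    private module H = Subgroup H

    stabilizer : Subgroup q k
    stabilizer = record
      { Member   = λ h → h ∈ H.Member × act h ψ ≅ ψ
      ; member?  = λ h → H.member? h ×-dec fixes? h
      ; 0∈       = H.0∈ , act-0 ψ
      ; ⊕-closed = λ {x} {y} (x∈ , xψ≅ψ) (y∈ , yψ≅ψ) → H.⊕-closed x∈ y∈ ,
          ≅-trans (≅-sym (act-⊕ x y ψ)) (≅-trans (relabel-cong _ yψ≅ψ) xψ≅ψ)
      ; ⊖-closed = λ {x} (x∈ , xψ≅ψ) → H.⊖-closed x∈ , act-⊖ x xψ≅ψ
      }

  -- Invariance assigns to each h a child isomorphic to the translate of `φ i` by h. The elements
  -- assigned to one child j lie in a single coset of the stabilizer; if there are any, `φ j` has
  -- the size of `φ i`. No quotient or orbit is formed.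
  orbit-size : ∀ (H : Subgroup q k) {g n} {φ : Vector (Formula (Variable q k)) (suc n)} → Invariant H (gate g φ) →
    ∀ i (fixes? : Decidable (λ h → act h (φ i) ≅ φ i)) →
    ∣ H ∣ * size (φ i) ≤ size (gate g φ) * ∣ stabilizer H (φ i) fixes? ∣
  orbit-size H {g} {n} {φ} inv i fixes? = begin
    ∣ H ∣ * size (φ i)
      ≤⟨ length-fibers (λ h j → image h Fin.≟ j) (size (φ i)) (λ j → size (φ j) * ∣ K ∣) (elements H.member?) (allFin (suc n))
           (λ {h} _ → ∈-allFin (image h)) (λ {j} _ → fiber j) ⟩
    sum (map (λ j → size (φ j) * ∣ K ∣) (allFin (suc n)))
      ≡⟨ sum-map-* (λ j → size (φ j)) ∣ K ∣ (allFin (suc n)) ⟩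
    sum (map (λ j → size (φ j)) (allFin (suc n))) * ∣ K ∣
      ≡⟨ cong (_* ∣ K ∣) (sum-map-allFin (λ j → size (φ j))) ⟩
    size (gate g φ) * ∣ K ∣ ∎
    where
    open ≤-Reasoning
    module H = Subgroup H
    K = stabilizer H (φ i) fixes?
    image : Vec (Fin q) k → Fin (suc n)
    image h with H.member? h
    ... | yes h∈ = proj₁ (relabel-child (inv h h∈) i)
    -- An arbitrary value: only members of H are counted.
    ... | no _   = i
    act-image : ∀ {h} → h ∈ H.Member → act h (φ i) ≅ φ (image h)
    act-image {h} h∈ with H.member? h
    ... | yes h∈′ = proj₂ (relabel-child (inv h h∈′) i)
    ... | no h∉   = contradiction h∈ h∉
    fiber : ∀ j → length (filter (λ h → image h Fin.≟ j) (elements H.member?)) * size (φ i) ≤ size (φ j) * ∣ K ∣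
    fiber j = bound _ (Unique.filter⁺ (λ h → image h Fin.≟ j) (elements-unique H.member?)) λ {h} h∈ →
      let h∈H , eq = ∈-filter⁻ (λ h → image h Fin.≟ j) {xs = elements H.member?} h∈ in
      ∈-elements⁻ H.member? h∈H , subst (λ j → act h (φ i) ≅ φ j) eq (act-image (∈-elements⁻ H.member? h∈H))
      where
      bound : ∀ hs → Unique hs → (∀ {h} → h ∈ˡ hs → h ∈ H.Member × act h (φ i) ≅ φ j) →
        length hs * size (φ i) ≤ size (φ j) * ∣ K ∣
      bound []            _      _      = z≤n
      bound hs@(h₀ ∷ _) unique fiber⁻ = begin
        length hs * size (φ i)   ≡⟨ cong (length hs *_) (trans (sym (size-relabel (translate h₀) (φ i))) (size-≅ (proj₂ (fiber⁻ (here refl))))) ⟩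
        length hs * size (φ j)   ≤⟨ *-monoˡ-≤ (size (φ j)) (length-coset _≟ᵛ_ (λ x y → (⊖ᵛ y) ⊕ᵛ x)
                                      (λ {x} {y} {z} → ⊕ᵛ.∙-cancelˡ (⊖ᵛ z) x y) unique closed) ⟩
        ∣ K ∣ * size (φ j)       ≡⟨ *-comm ∣ K ∣ (size (φ j)) ⟩
        size (φ j) * ∣ K ∣       ∎
        where
        closed : ∀ {x y} → x ∈ˡ hs → y ∈ˡ hs → ((⊖ᵛ y) ⊕ᵛ x) ∈ˡ elements (Subgroup.member? K)
        closed {x} {y} x∈ y∈ = ∈-elements⁺ (Subgroup.member? K)
          ( H.⊕-closed (H.⊖-closed (proj₁ (fiber⁻ y∈))) (proj₁ (fiber⁻ x∈))
          , ≅-trans (≅-sym (act-⊕ (⊖ᵛ y) x (φ i)))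
              (≅-trans (relabel-cong _ (proj₂ (fiber⁻ x∈))) (act-⊖ y (proj₂ (fiber⁻ y∈)))) )

-- Excluded middle is doubly negated at each vector, and double negation commutes with the finite
-- conjunction over `allVecs`.
¬¬-decidable : ∀ {n k} (P : Pred (Vec (Fin n) k) 0ℓ) → ¬ ¬ Decidable P
¬¬-decidable {n} {k} P ¬dec = all (allVecs n k) λ decs → ¬dec λ x → All.lookup decs (∈-allVecs x)
  where
  all : ∀ xs → ¬ ¬ All (λ x → Dec (P x)) xs
  all []       ¬all = ¬all []
  all (x ∷ xs) ¬all = ¬¬-excluded-middle λ px? → all xs λ pxs? → ¬all (px? ∷ pxs?)

-- Dimension and cardinality

module _ {p k : ℕ} .{{_ : NonZero p}} where

  linearCombination-⊕ : ∀ {r} (cs ds : Vec (Fin p) r) (vs : Vec (Vec (Fin p) k) r) →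
    linearCombination (cs ⊕ᵛ ds) vs ≡ linearCombination cs vs ⊕ᵛ linearCombination ds vs
  linearCombination-⊕ []       []       []       = sym (⊕ᵛ.identityˡ 0ᵛ)
  linearCombination-⊕ (c ∷ cs) (d ∷ ds) (v ∷ vs) =
    trans (cong₂ _⊕ᵛ_ (⊗ᵛ-distribʳ-⊕ v c d) (linearCombination-⊕ cs ds vs))
          (⊕ᵛ.interchange (c ⊗ᵛ v) (d ⊗ᵛ v) (linearCombination cs vs) (linearCombination ds vs))

  module _ (V : Subspace p k) {r : ℕ} (vs : Vec (Vec (Fin p) k) r) (basis : IsBasis V vs) where

    open Subspace V
    open IsBasis basis

    linearCombination-∈ : ∀ cs → linearCombination cs vs ∈ Member
    linearCombination-∈ cs = go cs members
      where
      go : ∀ {r} (cs : Vec (Fin p) r) {vs} → Vec.All (_∈ Member) vs → linearCombination cs vs ∈ Member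
      go []       []         = 0∈
      go (c ∷ cs) (v∈ ∷ vs∈) = ⊕-closed (⊗-closed c v∈) (go cs vs∈)

    linearCombination-injective : ∀ {cs ds} → linearCombination cs vs ≡ linearCombination ds vs → cs ≡ ds
    linearCombination-injective {cs} {ds} eq = ⊕ᵛ.x∙y⁻¹≈ε⇒x≈y cs ds (independent e
      (⊕ᵛ.∙-cancelʳ (linearCombination ds vs) (linearCombination e vs) 0ᵛ (begin
        linearCombination e vs ⊕ᵛ linearCombination ds vs    ≡⟨ linearCombination-⊕ e ds vs ⟨
        linearCombination (e ⊕ᵛ ds) vs                       ≡⟨ cong (λ z → linearCombination z vs) (⊕ᵛ.//-rightDividesˡ ds cs) ⟩
        linearCombination cs vs                              ≡⟨ eq ⟩
        linearCombination ds vs                              ≡⟨ ⊕ᵛ.identityˡ _ ⟨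
        0ᵛ ⊕ᵛ linearCombination ds vs                        ∎)))
      where
      open ≡-Reasoning
      e = cs ⊕ᵛ (⊖ᵛ ds)

    -- Subspaces carry no decision procedure; for W it is a search through the coefficient vectors
    -- of its basis.
    basis⇒decidable : Decidable Member
    basis⇒decidable x = map′
      (λ any → let cs , _ , eq = find any in subst Member eq (linearCombination-∈ cs))
      (λ x∈ → let cs , eq = spanning x∈ in lose (∈-allVecs cs) eq)
      (Any.any? (λ cs → linearCombination cs vs ≟ᵛ x) (allVecs p r))

    #≤p^dim : ∀ (V? : Decidable Member) → # V? ≤ p ^ r
    #≤p^dim V? = begin
      # V?                                                         ≤⟨ length-injection _≟ᵛ_ (λ x → x) (elements-unique V?) (λ _ _ eq → eq) maps ⟩
      length (map (λ cs → linearCombination cs vs) (allVecs p r))  ≡⟨ length-map _ (allVecs p r) ⟩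
      length (allVecs p r)                                         ≡⟨ length-allVecs p r ⟩
      p ^ r                                                        ∎
      where
      open ≤-Reasoning
      maps : ∀ {x} → x ∈ˡ elements V? → x ∈ˡ map (λ cs → linearCombination cs vs) (allVecs p r)
      maps x∈ with cs , refl ← spanning (∈-elements⁻ V? x∈) = ∈-map⁺ (λ cs → linearCombination cs vs) (∈-allVecs cs)

    p^dim≤# : ∀ (V? : Decidable Member) → p ^ r ≤ # V?
    p^dim≤# V? = ≤-trans (≤-reflexive (sym (length-allVecs p r)))
      (length-injection _≟ᵛ_ (λ cs → linearCombination cs vs) (allVecs-unique p r)
        (λ _ _ → linearCombination-injective) (λ {cs} _ → ∈-elements⁺ V? (linearCombination-∈ cs)))

-- Torsion and the order of H

module _ {p t q : ℕ} .{{_ : NonZero p}} .{{_ : NonZero q}} (1≤t : 1 ≤ t) (q≡p^t : q ≡ p ^ t) where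

  private
    P = p ^ (t ∸ 1)

    q≡p*P : q ≡ p * P
    q≡p*P = trans q≡p^t (lemma 1≤t)
      where
      lemma : ∀ {t} → 1 ≤ t → p ^ t ≡ p * p ^ (t ∸ 1)
      lemma (s≤s _) = refl

    mod≡0⇒%≡0 : ∀ {m} → m mod q ≡ 0# → m % q ≡ 0
    mod≡0⇒%≡0 {m} eq = trans (sym (toℕ-mod m q)) (trans (cong toℕ eq) (trans (toℕ-mod 0 q) (m<n⇒m%n≡m (>-nonZero⁻¹ q))))

  -- For a < p the product a·pᵗ⁻¹ is below q, so it is not reduced.
  embed≡0⇒≡0 : ∀ a → embed p t q a ≡ 0# → a ≡ 0#
  embed≡0⇒≡0 a eq = trans (sym (toℕ-mod-id a)) (cong (_mod p) a≡0)
    where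
    aP<q : toℕ a * P < q
    aP<q = subst (toℕ a * P <_) (sym q≡p*P) (*-monoˡ-< P {{m^n≢0 p (t ∸ 1)}} (Fin.toℕ<n a))
    a≡0 : toℕ a ≡ 0
    a≡0 = m*n≡0⇒m≡0 (toℕ a) P {{m^n≢0 p (t ∸ 1)}} (trans (sym (m<n⇒m%n≡m aP<q)) (mod≡0⇒%≡0 eq))

  -- Since q = p·P divides p·a, cancelling p leaves P ∣ a, and the quotient modulo p is the
  -- preimage.
  p-torsion⇒embed : ∀ (a : Fin q) → (p mod q) ⊗ a ≡ 0# → ∃[ b ] embed p t q b ≡ a
  p-torsion⇒embed a pa≡0 with *-cancelˡ-∣ p (subst (_∣ p * toℕ a) q≡p*P
    (m%n≡0⇒n∣m (p * toℕ a) q (mod≡0⇒%≡0 (trans (sym (mod-⊗ʳ p a)) pa≡0))))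
  ... | divides c a≡cP = c mod p ,
    trans (embed-mod p t q 1≤t q≡p^t c) (trans (cong (_mod q) (sym a≡cP)) (toℕ-mod-id a))

  p-torsion⇒embedᵛ : ∀ {k} (x : Vec (Fin q) k) → (p mod q) ⊗ᵛ x ≡ 0ᵛ → ∃[ y ] embedᵛ p t q y ≡ x
  p-torsion⇒embedᵛ []      eq = [] , refl
  p-torsion⇒embedᵛ (a ∷ x) eq
    with b , refl ← p-torsion⇒embed a (Vec.∷-injectiveˡ eq)
       | y , refl ← p-torsion⇒embedᵛ x (Vec.∷-injectiveʳ eq) = b ∷ y , refl

  module _ {k : ℕ} (H : Subgroup q k) where

    open Subgroup H

    V? : Decidable (Subspace.Member (V[_] p t q 1≤t q≡p^t H))
    V? x = member? (embedᵛ p t q x)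

    private
      multiple-∈ : ∀ m {h} → h ∈ Member → (m mod q) ⊗ᵛ h ∈ Member
      multiple-∈ zero    {h} h∈ = subst Member (sym (⊗ᵛ-zeroˡ h)) 0∈
      multiple-∈ (suc m) {h} h∈ = subst Member (sym (begin
        (suc m mod q) ⊗ᵛ h                ≡⟨ cong (_⊗ᵛ h) (mod-⊕ 1 m q) ⟨
        (1# ⊕ (m mod q)) ⊗ᵛ h             ≡⟨ ⊗ᵛ-distribʳ-⊕ h 1# (m mod q) ⟩
        1# ⊗ᵛ h ⊕ᵛ (m mod q) ⊗ᵛ h         ≡⟨ cong (_⊕ᵛ (m mod q) ⊗ᵛ h) (⊗ᵛ-identityˡ h) ⟩
        h ⊕ᵛ (m mod q) ⊗ᵛ h               ∎)) (⊕-closed h∈ (multiple-∈ m h∈))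
        where open ≡-Reasoning

      Torsion : ℕ → Pred (Vec (Fin q) k) 0ℓ
      Torsion i h = h ∈ Member × ((p ^ i) mod q) ⊗ᵛ h ≡ 0ᵛ

      torsion? : ∀ i → Decidable (Torsion i)
      torsion? i h = member? h ×-dec (((p ^ i) mod q) ⊗ᵛ h ≟ᵛ 0ᵛ)

      torsion-suc : ∀ i → # (torsion? (suc i)) ≤ # V? * # (torsion? i)
      torsion-suc i = begin
        # (torsion? (suc i))                              ≡⟨ *-identityʳ _ ⟨
        # (torsion? (suc i)) * 1                          ≤⟨ length-fibers R? 1 (λ _ → # (torsion? i)) (elements (torsion? (suc i))) (elements V?) hit (λ {x} _ → fiber x) ⟩
        sum (map (λ _ → # (torsion? i)) (elements V?))    ≡⟨ sum-map-const (# (torsion? i)) (elements V?) ⟩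
        # V? * # (torsion? i)                             ∎
        where
        open ≤-Reasoning
        pⁱ = (p ^ i) mod q
        R? : ∀ h x → Dec (embedᵛ p t q x ≡ pⁱ ⊗ᵛ h)
        R? h x = embedᵛ p t q x ≟ᵛ (pⁱ ⊗ᵛ h)
        hit : ∀ {h} → h ∈ˡ elements (torsion? (suc i)) → Any.Any (λ x → embedᵛ p t q x ≡ pⁱ ⊗ᵛ h) (elements V?)
        hit {h} h∈ =
          let h∈H , pⁱ⁺¹h≡0 = ∈-elements⁻ (torsion? (suc i)) h∈
              x , eq = p-torsion⇒embedᵛ (pⁱ ⊗ᵛ h) (trans (sym (Vec.map-∘ _ _ h)) (trans (Vec.map-cong
                (λ a → trans (sym (⊗-assoc (p mod q) pⁱ a)) (cong (_⊗ a) (mod-⊗ p (p ^ i)))) h) pⁱ⁺¹h≡0))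
          in lose (∈-elements⁺ V? (subst Member (sym eq) (multiple-∈ (p ^ i) h∈H))) eq
        fiber : ∀ x → length (filter (λ h → R? h x) (elements (torsion? (suc i)))) * 1 ≤ # (torsion? i)
        fiber x = ≤-trans (≤-reflexive (*-identityʳ _)) (length-coset _≟ᵛ_ (λ g h → (⊖ᵛ h) ⊕ᵛ g)
          (λ {g} {h} {z} → ⊕ᵛ.∙-cancelˡ (⊖ᵛ z) g h)
          (Unique.filter⁺ (λ h → R? h x) (elements-unique (torsion? (suc i)))) closed)
          where
          fiber⁻ : ∀ {h} → h ∈ˡ filter (λ h → R? h x) (elements (torsion? (suc i))) → h ∈ Member × embedᵛ p t q x ≡ pⁱ ⊗ᵛ h
          fiber⁻ h∈ = let h∈T , eq = ∈-filter⁻ (λ h → R? h x) {xs = elements (torsion? (suc i))} h∈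
                      in proj₁ (∈-elements⁻ (torsion? (suc i)) h∈T) , eq
          closed : ∀ {g h} → g ∈ˡ filter (λ h → R? h x) (elements (torsion? (suc i))) →
            h ∈ˡ filter (λ h → R? h x) (elements (torsion? (suc i))) → (⊖ᵛ h) ⊕ᵛ g ∈ˡ elements (torsion? i)
          closed {g} {h} g∈ h∈ with fiber⁻ g∈ | fiber⁻ h∈
          ... | g∈H , xg | h∈H , xh = ∈-elements⁺ (torsion? i)
            (⊕-closed (⊖-closed h∈H) g∈H , ⊕ᵛ.∙-cancelˡ (pⁱ ⊗ᵛ h) (pⁱ ⊗ᵛ ((⊖ᵛ h) ⊕ᵛ g)) 0ᵛ
              (trans (sym (⊗ᵛ-distribˡ-⊕ᵛ pⁱ h ((⊖ᵛ h) ⊕ᵛ g))) (trans (cong (pⁱ ⊗ᵛ_) (⊕ᵛ.\\-leftDividesˡ h g))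
                (trans (sym xg) (trans xh (sym (⊕ᵛ.identityʳ _)))))))

      torsion≤ : ∀ i → # (torsion? i) ≤ # V? ^ i
      torsion≤ zero    = length-injection _≟ᵛ_ (λ h → h) {ys = 0ᵛ ∷ []} (elements-unique (torsion? 0)) (λ _ _ eq → eq)
        λ {h} h∈ → here (trans (sym (⊗ᵛ-identityˡ h)) (proj₂ (∈-elements⁻ (torsion? 0) h∈)))
      torsion≤ (suc i) = ≤-trans (torsion-suc i) (*-monoʳ-≤ (# V?) (torsion≤ i))

    -- Multiplication by pⁱ embeds H[pⁱ⁺¹]/H[pⁱ] into V_H, hence |H| ≤ |V_H|ᵗ.
    ∣H∣≤q^r : ∀ {r} → # V? ≤ p ^ r → ∣ H ∣ ≤ q ^ r
    ∣H∣≤q^r {r} #V≤ = begin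
      ∣ H ∣             ≤⟨ #-mono member? (torsion? t) (λ {h} h∈ → h∈ , trans (cong (_⊗ᵛ h) p^t≡0) (⊗ᵛ-zeroˡ h)) ⟩
      # (torsion? t)    ≤⟨ torsion≤ t ⟩
      # V? ^ t          ≤⟨ ^-monoˡ-≤ t #V≤ ⟩
      (p ^ r) ^ t       ≡⟨ trans (^-*-assoc p r t) (trans (cong (p ^_) (*-comm r t)) (sym (^-*-assoc p t r))) ⟩
      (p ^ t) ^ r       ≡⟨ cong (_^ r) q≡p^t ⟨
      q ^ r             ∎
      where
      open ≤-Reasoning
      p^t≡0 : (p ^ t) mod q ≡ 0#
      p^t≡0 = trans (cong (_mod q) (trans (sym q≡p^t) (sym (*-identityˡ q)))) (n*-mod 1)

-- The induction

-- The orbit inequality hs ≤ Sκ trades κ for h, and qⁱ raises q^r′ to q^r. The truncated difference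
-- does no harm, as a ≤ ib + (a ∸ ib).
combine-powers : ∀ q .{{_ : NonZero q}} {h κ s S r r′} i a b .{{_ : NonZero κ}} → i + r′ ≡ r → h * s ≤ S * κ →
  κ ^ b * q ^ (a ∸ i * b) ≤ (s * q ^ r′) ^ b → h ^ b * q ^ a ≤ (S * q ^ r) ^ b
combine-powers q {h} {κ} {s} {S} {_} {r′} i a b refl hs≤Sκ ih = *-cancelˡ-≤ (κ ^ b) {{m^n≢0 κ b}} (begin
  κ ^ b * (h ^ b * q ^ a)                          ≤⟨ *-monoʳ-≤ (κ ^ b) (*-monoʳ-≤ (h ^ b) (^-monoʳ-≤ q (m≤n+m∸n a (i * b)))) ⟩
  κ ^ b * (h ^ b * q ^ (i * b + (a ∸ i * b)))      ≡⟨ cong (λ z → κ ^ b * (h ^ b * z)) (^-distribˡ-+-* q (i * b) (a ∸ i * b)) ⟩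
  κ ^ b * (h ^ b * (q ^ (i * b) * q ^ (a ∸ i * b))) ≡⟨ lemma₁ (κ ^ b) (h ^ b) (q ^ (i * b)) (q ^ (a ∸ i * b)) ⟩
  h ^ b * (κ ^ b * q ^ (a ∸ i * b)) * q ^ (i * b)  ≤⟨ *-monoˡ-≤ (q ^ (i * b)) (*-monoʳ-≤ (h ^ b) ih) ⟩
  h ^ b * (s * q ^ r′) ^ b * q ^ (i * b)           ≡⟨ cong₂ _*_ (^-distribʳ-* b h (s * q ^ r′)) (^-*-assoc q i b) ⟨
  (h * (s * q ^ r′)) ^ b * (q ^ i) ^ b             ≡⟨ ^-distribʳ-* b _ (q ^ i) ⟨
  (h * (s * q ^ r′) * q ^ i) ^ b                   ≡⟨ cong (_^ b) (lemma₂ h s (q ^ r′) (q ^ i)) ⟩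
  (h * s * (q ^ i * q ^ r′)) ^ b                   ≤⟨ ^-monoˡ-≤ b (*-monoˡ-≤ (q ^ i * q ^ r′) hs≤Sκ) ⟩
  (S * κ * (q ^ i * q ^ r′)) ^ b                   ≡⟨ cong (λ z → (S * κ * z) ^ b) (^-distribˡ-+-* q i r′) ⟨
  (S * κ * q ^ (i + r′)) ^ b                       ≡⟨ cong (_^ b) (lemma₃ S κ (q ^ (i + r′))) ⟩
  (κ * (S * q ^ (i + r′))) ^ b                     ≡⟨ ^-distribʳ-* b κ _ ⟩
  κ ^ b * (S * q ^ (i + r′)) ^ b                   ∎)
  where
  open ≤-Reasoning
  lemma₁ : ∀ κ h x y → κ * (h * (x * y)) ≡ h * (κ * y) * x
  lemma₁ = solve-∀
  lemma₂ : ∀ h s x y → h * (s * x) * y ≡ h * s * (y * x)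
  lemma₂ = solve-∀
  lemma₃ : ∀ S κ x → S * κ * x ≡ κ * (S * x)
  lemma₃ = solve-∀

module _ {p t q : ℕ} .{{_ : NonZero p}} .{{_ : NonZero q}} (isPrime : Prime p) (1≤t : 1 ≤ t) (q≡p^t : q ≡ p ^ t)
         {k : ℕ} where

  private
    ι : Vec (Fin p) k → Vec (Fin q) k
    ι = embedᵛ p t q

    value : Formula (Variable q k) → Vec (Fin p) k → Bool
    value Φ x = eval Φ (point (ι x))

    V : Subgroup q k → Subspace p k
    V = V[_] p t q 1≤t q≡p^t

  -- W = V_H + ⟨w⟩ and m ≤ μ(V_H,W); φ₀ only witnesses that the minimum is over a nonempty set.
  record Hypotheses (Φ : Formula (Variable q k)) (H : Subgroup q k) (r m : ℕ) : Set where
    field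
      invariant   : Invariant H Φ
      #V≤         : # (V? 1≤t q≡p^t H) ≤ p ^ r
      w φ₀        : Vec (Fin p) k
      φ₀∈         : φ₀ ∈ V H ^⊥
      wφ₀≢0       : dot w φ₀ ≢ 0#
      minimal     : ∀ u → u ∈ V H ^⊥ → dot w u ≢ 0# → m ≤ weight u
      c c′        : Fin p
      nonconstant : value Φ (c ⊗ᵛ w) ≢ value Φ (c′ ⊗ᵛ w)

  module _ {Q : ℕ → ℕ → ℕ → ℕ → Set} (admissible : Admissible Q) where

    -- All of H, r and m are quantified here because a child is used with its own stabilizer and
    -- another line.
    LowerBound : ℕ → Formula (Variable q k) → Set₁
    LowerBound d Φ = ∀ {H r m} → Hypotheses Φ H r m → ∀ a b .{{_ : NonZero b}} → Q d m a b →
      ∣ H ∣ ^ b * q ^ a ≤ (size Φ * q ^ r) ^ b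

    open Admissible admissible

    -- Invariance of a literal in the i-th matrix forces every h in H to be 0 at i, so `unit i`
    -- annihilates V_H. The literal reads only coordinate i, so nonconstancy on the line forces w to
    -- be nonzero there. Hence `unit i` competes for the minimum and m ≤ 1. The parameter `l` covers
    -- both signs.
    literal-bound : ∀ d x (l : Variable q k → Literal (Variable q k)) →
      (∀ σ y → relabelLiteral σ (l y) ≡ l (σ y)) →
      (∀ {y z} → lit (l y) ≅ lit (l z) → y ≡ z) →
      (∀ {ρ ρ′} → ρ x ≡ ρ′ x → evalLiteral ρ (l x) ≡ evalLiteral ρ′ (l x)) →
      LowerBound d (lit (l x))
    literal-bound d (i , α , β) l l-relabel l-injective l-eval {H} {r} {m} hyp a b Qdmab = begin
        ∣ H ∣ ^ b * q ^ a   ≡⟨ cong (λ z → ∣ H ∣ ^ b * q ^ z) (leaf d (≤-trans (minimal (unit i) unit∈ w·unit≢0) (weight-unit i)) Qdmab) ⟩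
        ∣ H ∣ ^ b * 1       ≡⟨ *-identityʳ _ ⟩
        ∣ H ∣ ^ b           ≤⟨ ^-monoˡ-≤ b (∣H∣≤q^r 1≤t q≡p^t H {r} #V≤) ⟩
        (q ^ r) ^ b         ≡⟨ cong (_^ b) (*-identityˡ (q ^ r)) ⟨
        (1 * q ^ r) ^ b     ∎
      where
      open ≤-Reasoning
      open Hypotheses hyp
      fixed : ∀ {h} → h ∈ Subgroup.Member H → lookup h i ≡ 0#
      fixed {h} h∈ = ⊕.∙-cancelʳ α (lookup h i) 0# (trans (cong (λ x → proj₁ (proj₂ x))
        (l-injective (subst (λ z → lit z ≅ lit (l (i , α , β))) (l-relabel (translate h) (i , α , β)) (invariant h h∈)))) (sym (⊕-identityˡ α)))
      unit∈ : unit i ∈ V H ^⊥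
      unit∈ x x∈ = trans (dot-unit x i) (embed≡0⇒≡0 1≤t q≡p^t (lookup x i)
        (trans (sym (Vec.lookup-map i (embed p t q) x)) (fixed x∈)))
      w·unit≢0 : dot w (unit i) ≢ 0#
      w·unit≢0 eq = nonconstant (l-eval (cong (λ z → permutationMatrix z α β) (trans (vanishes c) (sym (vanishes c′)))))
        where
        vanishes : ∀ c → lookup (ι (c ⊗ᵛ w)) i ≡ embed p t q 0#
        vanishes c = trans (Vec.lookup-map i (embed p t q) (c ⊗ᵛ w)) (cong (embed p t q)
          (trans (Vec.lookup-map i (c ⊗_) w) (trans (cong (c ⊗_) (trans (sym (dot-unit w i)) eq)) (⊗-zeroʳ c))))

    leaf-bound : ∀ d l → LowerBound d (lit l)
    leaf-bound d (pos x) = literal-bound d x pos (λ _ _ → refl) (λ { (lit _) → refl }) (λ eq → eq)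
    leaf-bound d (neg x) = literal-bound d x neg (λ _ _ → refl) (λ { (lit _) → refl }) (cong not)

    module _ {d g n} {φ : Vector (Formula (Variable q k)) (suc n)} (ih : ∀ i → LowerBound d (φ i))
             {H : Subgroup q k} {r m : ℕ} (hyp : Hypotheses (gate g φ) H r m) where

      private
        module H = Subgroup H
        module VH = Subspace (V H)

      open Hypotheses hyp

      private
        value-coset : ∀ {y} → y ∈ VH.Member → ∀ x → value (gate g φ) (y ⊕ᵛ x) ≡ value (gate g φ) x
        value-coset {y} y∈ x = trans (cong (λ z → eval (gate g φ) (point z)) (embedᵛ-⊕ p t q 1≤t q≡p^t y x))
          (eval-invariant H invariant y∈ (ι x))

        module Step (c c′ : Fin p) (≡neutral : value (gate g φ) (c ⊗ᵛ w) ≡ neutral {Variable q k} g)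
          {i₀ : Fin (suc n)} (≢neutral : value (φ i₀) (c′ ⊗ᵛ w) ≢ neutral {Variable q k} g)
          (fixes? : Decidable (λ h → act h (φ i₀) ≅ φ i₀)) where

          K = stabilizer H (φ i₀) fixes?

          open Descent (descent isPrime {V′ = V K} (V? 1≤t q≡p^t K) r {V H} (V? 1≤t q≡p^t H) proj₁ #V≤ {w} {φ₀} φ₀∈ wφ₀≢0)
            renaming (minimal to minimal′; m to m′; φ to φ₁)

          y-shift : ∀ e → e ⊗ᵛ (w ⊕ᵛ y) ≡ e ⊗ᵛ y ⊕ᵛ e ⊗ᵛ w
          y-shift e = trans (⊗ᵛ-distribˡ-⊕ᵛ e w y) (⊕ᵛ.comm (e ⊗ᵛ w) (e ⊗ᵛ y))

          -- Within its orbit the child can be replaced by one that is nonconstant on the line through w + y.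
          h = ι (c′ ⊗ᵛ y)

          h∈ : h ∈ H.Member
          h∈ = VH.⊗-closed c′ y∈

          i₁ : Fin (suc n)
          i₁ = proj₁ (relabel-child (invariant h h∈) i₀)

          hφ≅ : act h (φ i₀) ≅ φ i₁
          hφ≅ = proj₂ (relabel-child (invariant h h∈) i₀)

          -- The gate is still neutral at this point, which differs from c·w by an element of V_H,
          -- and a neutral gate leaves none of its children a choice.
          value-c : value (φ i₁) (c ⊗ᵛ (w ⊕ᵛ y)) ≡ neutral {Variable q k} g
          value-c = eval-neutral⁻ g φ (trans (cong (value (gate g φ)) (y-shift c))
            (trans (value-coset (VH.⊗-closed c y∈) (c ⊗ᵛ w)) ≡neutral)) i₁

          -- By the choice of h, the translation that carries `φ i₀` to `φ i₁` also carries c′·w to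
          -- c′·(w + y).
          value-c′ : value (φ i₁) (c′ ⊗ᵛ (w ⊕ᵛ y)) ≡ value (φ i₀) (c′ ⊗ᵛ w)
          value-c′ = begin
            value (φ i₁) (c′ ⊗ᵛ (w ⊕ᵛ y))                          ≡⟨ cong (value (φ i₁)) (y-shift c′) ⟩
            value (φ i₁) (c′ ⊗ᵛ y ⊕ᵛ c′ ⊗ᵛ w)                      ≡⟨ cong (λ z → eval (φ i₁) (point z)) (embedᵛ-⊕ p t q 1≤t q≡p^t (c′ ⊗ᵛ y) (c′ ⊗ᵛ w)) ⟩
            eval (φ i₁) (point (h ⊕ᵛ ι (c′ ⊗ᵛ w)))                 ≡⟨ eval-≅ hφ≅ _ ⟨
            eval (act h (φ i₀)) (point (h ⊕ᵛ ι (c′ ⊗ᵛ w)))         ≡⟨ eval-act h (ι (c′ ⊗ᵛ w)) (φ i₀) ⟩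
            value (φ i₀) (c′ ⊗ᵛ w)                                 ∎
            where open ≡-Reasoning

          K-invariant : Invariant K (φ i₁)
          K-invariant e (_ , eφ≅φ) = ≅-trans (relabel-cong _ (≅-sym hφ≅)) (≅-trans (act-comm e h (φ i₀))
            (≅-trans (relabel-cong _ eφ≅φ) hφ≅))

          child : Hypotheses (φ i₁) K r′ m′
          child = record
            { invariant = K-invariant ; #V≤ = #V′≤ ; w = w ⊕ᵛ y ; φ₀ = φ₀
            ; φ₀∈ = λ x x∈ → φ₀∈ x (proj₁ x∈)
            ; wφ₀≢0 = λ eq → wφ₀≢0 (trans (sym (trans (dot-⊕ˡ w y φ₀) (trans (cong (dot w φ₀ ⊕_) (φ₀∈ y y∈)) (⊕-identityʳ _)))) eq)
            ; minimal = minimal′ ; c = c ; c′ = c′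
            ; nonconstant = λ eq → ≢neutral (trans (sym value-c′) (trans (sym eq) value-c)) }

          bound : ∀ a b .{{_ : NonZero b}} → Q (suc d) m a b → ∣ H ∣ ^ b * q ^ a ≤ (size (gate g φ) * q ^ r) ^ b
          bound a b Qab = combine-powers q {∣ H ∣} {∣ K ∣} {size (φ i₁)} {size (gate g φ)} i a b {{>-nonZero (#-positive (Subgroup.member? K) (Subgroup.0∈ K))}} i+r′≡r
            (≤-trans (≤-reflexive (cong (∣ H ∣ *_) (trans (sym (size-≅ hφ≅)) (size-relabel (translate h) (φ i₀)))))
              (orbit-size H {g} {φ = φ} invariant i₀ fixes?))
            (ih i₁ child (a ∸ i * b) b (step d i (≤-trans (minimal φ₁ φ∈ vφ≢0) weight≤) Qab))

        -- The order on ℕ is stable, so stabilizers may be taken to be decidable.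
        ordered : ∀ c c′ → value (gate g φ) (c ⊗ᵛ w) ≡ neutral {Variable q k} g → value (gate g φ) (c′ ⊗ᵛ w) ≢ neutral {Variable q k} g →
          ∀ a b .{{_ : NonZero b}} → Q (suc d) m a b → ∣ H ∣ ^ b * q ^ a ≤ (size (gate g φ) * q ^ r) ^ b
        ordered c c′ ≡neutral ≢neutral a b Qab = decidable-stable (_ ≤? _) λ ¬bound →
          let i₀ , i₀≢neutral = eval-≢neutral g φ ≢neutral in
          ¬¬-decidable (λ h → act h (φ i₀) ≅ φ i₀) λ fixes? →
            ¬bound (Step.bound c c′ ≡neutral i₀≢neutral fixes? a b Qab)

      gate-bound : ∀ a b .{{_ : NonZero b}} → Q (suc d) m a b → ∣ H ∣ ^ b * q ^ a ≤ (size (gate g φ) * q ^ r) ^ b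
      gate-bound with value (gate g φ) (c ⊗ᵛ w) Bool.≟ neutral {Variable q k} g
      ... | yes ≡neutral = ordered c c′ ≡neutral (λ eq → nonconstant (trans ≡neutral (sym eq)))
      ... | no ≢neutral  = ordered c′ c (trans (Bool.¬-not (λ eq → nonconstant (sym eq))) (sym (Bool.¬-not (λ eq → ≢neutral (sym eq))))) ≢neutral

    lower-bound : ∀ d Φ → depth Φ ≤ d → LowerBound d Φ
    lower-bound d       (const b)  _             hyp = contradiction refl (Hypotheses.nonconstant hyp)
    lower-bound d       (lit l)    _             hyp = leaf-bound d l hyp
    lower-bound (suc d) (gate g φ) (s≤s depth≤) hyp =
      gate-bound (λ i → lower-bound d (φ i) (≤-trans (depth-child φ i) depth≤)) hyp

  -- From the subspace W to a line ⟨w⟩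

  module _ (H : Subgroup q k) (W : Subspace p k) (V⊂W : Subspace.Member (V H) ⊂ Subspace.Member W)
           {r : ℕ} (dimV : HasDimension (V H) r) (dimW : HasDimension W (suc r)) {μ : ℕ} (isMu : IsMu (V H) W μ)
           {Φ : Formula (Variable q k)} (inv : Invariant H Φ)
           (nonconst : NonconstantOn (Subspace.Member W) (value Φ)) where

    private
      module W = Subspace W
      open IsMu isMu
      φ₀ = proj₁ attained
      W? = basis⇒decidable W (proj₁ dimW) (proj₂ dimW)

      outside : ∃[ w ] w ∈ W.Member × dot w φ₀ ≢ 0#
      outside with annihilates? {V = W} W? φ₀
      ... | inj₁ φ₀∈W⊥ = contradiction φ₀∈W⊥ (proj₁ (proj₂ (proj₂ attained)))
      ... | inj₂ w     = w

      w = proj₁ outside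
      w∈ = proj₁ (proj₂ outside)
      wφ₀≢0 = proj₂ (proj₂ outside)

      -- The kernel of φ₀ in W contains V_H and has at most p^(r+1)/p = p^r elements, as many as
      -- V_H. So the two coincide, and W = V_H + ⟨w⟩.
      W∩ker⊆V : ∀ {x} → x ∈ Subspace.Member (W ∩ker φ₀) → x ∈ Subspace.Member (V H)
      W∩ker⊆V = #-reflects-⊇ (V? 1≤t q≡p^t H) W₀? (λ {x} x∈ → proj₁ V⊂W x∈ , proj₁ (proj₂ attained) x x∈)
        (*-cancelʳ-≤ _ _ p (begin
          # W₀? * p                       ≤⟨ #-∩ker isPrime {V = W} W? {φ₀} {w} w∈ wφ₀≢0 ⟩
          # W?                            ≤⟨ #≤p^dim W (proj₁ dimW) (proj₂ dimW) W? ⟩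
          p * p ^ r                       ≡⟨ *-comm p (p ^ r) ⟩
          p ^ r * p                       ≤⟨ *-monoˡ-≤ p (p^dim≤# (V H) (proj₁ dimV) (proj₂ dimV) (V? 1≤t q≡p^t H)) ⟩
          # (V? 1≤t q≡p^t H) * p          ∎))
        where
        open ≤-Reasoning
        W₀? = ∩ker? {V = W} W? φ₀

      -- Subtracting from x the multiple of w with the same product with φ₀ leaves an element z of
      -- V_H, and Φ is invariant under z.
      onLine : ∀ {x} → x ∈ W.Member → ∃[ c ] value Φ x ≡ value Φ (c ⊗ᵛ w)
      onLine {x} x∈ = ⊖ c , (begin
        value Φ x                                    ≡⟨ cong (value Φ) x≡ ⟨
        value Φ (z ⊕ᵛ (⊖ c) ⊗ᵛ w)                    ≡⟨ cong (λ v → eval Φ (point v)) (embedᵛ-⊕ p t q 1≤t q≡p^t z ((⊖ c) ⊗ᵛ w)) ⟩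
        eval Φ (point (ι z ⊕ᵛ ι ((⊖ c) ⊗ᵛ w)))       ≡⟨ eval-invariant H inv z∈ (ι ((⊖ c) ⊗ᵛ w)) ⟩
        value Φ ((⊖ c) ⊗ᵛ w)                         ∎)
        where
        open ≡-Reasoning
        c = proj₁ (⊗-eliminate isPrime wφ₀≢0 (dot x φ₀))
        z = x ⊕ᵛ c ⊗ᵛ w
        z∈ : z ∈ Subspace.Member (V H)
        z∈ = W∩ker⊆V (W.⊕-closed x∈ (W.⊗-closed c w∈) ,
          trans (dot-⊕ˡ x (c ⊗ᵛ w) φ₀) (trans (cong (dot x φ₀ ⊕_) (dot-⊗ˡ c w φ₀)) (proj₂ (⊗-eliminate isPrime wφ₀≢0 (dot x φ₀)))))
        x≡ : z ⊕ᵛ (⊖ c) ⊗ᵛ w ≡ x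
        x≡ = begin
          (x ⊕ᵛ c ⊗ᵛ w) ⊕ᵛ (⊖ c) ⊗ᵛ w      ≡⟨ ⊕ᵛ.assoc x (c ⊗ᵛ w) ((⊖ c) ⊗ᵛ w) ⟩
          x ⊕ᵛ (c ⊗ᵛ w ⊕ᵛ (⊖ c) ⊗ᵛ w)      ≡⟨ cong (x ⊕ᵛ_) (⊗ᵛ-distribʳ-⊕ w c (⊖ c)) ⟨
          x ⊕ᵛ (c ⊕ (⊖ c)) ⊗ᵛ w            ≡⟨ cong (λ e → x ⊕ᵛ e ⊗ᵛ w) (⊖-inverseʳ c) ⟩
          x ⊕ᵛ 0# ⊗ᵛ w                     ≡⟨ cong (x ⊕ᵛ_) (⊗ᵛ-zeroˡ w) ⟩
          x ⊕ᵛ 0ᵛ                          ≡⟨ ⊕ᵛ.identityʳ x ⟩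
          x                                ∎

    hypotheses : Hypotheses Φ H r μ
    hypotheses = let _ , _ , x∈ , y∈ , ≢ = nonconst in record
      { invariant = inv ; #V≤ = #≤p^dim (V H) (proj₁ dimV) (proj₂ dimV) (V? 1≤t q≡p^t H)
      ; w = w ; φ₀ = φ₀ ; φ₀∈ = proj₁ (proj₂ attained) ; wφ₀≢0 = wφ₀≢0
      ; minimal = λ u u∈ wu≢0 → minimal u u∈ (λ u∈W⊥ → wu≢0 (u∈W⊥ w w∈))
      ; c = proj₁ (onLine x∈) ; c′ = proj₁ (onLine y∈)
      ; nonconstant = λ eq → ≢ (trans (proj₂ (onLine x∈)) (trans eq (sym (proj₂ (onLine y∈))))) }

theorem7p7 : (p t q k : ℕ) .{{_ : NonZero p}} .{{_ : NonZero q}} →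
    Prime p → (1≤t : 1 ≤ t) → (q≡p^t : q ≡ p ^ t) → 1 ≤ k →
    (H : Subgroup q k) (W : Subspace p k) →
    let V_H = V[_] p t q 1≤t q≡p^t H in
    Subspace.Member V_H ⊂ Subspace.Member W →
    (dimV : ℕ) → HasDimension V_H dimV → HasDimension W (suc dimV) →
    (μ : ℕ) → IsMu V_H W μ →
    (Φ : Formula (Variable q k)) →
    Invariant H Φ →
    NonconstantOn (Subspace.Member W) (λ w → eval Φ (point (embedᵛ p t q w))) →
    ((d : ℕ) → 1 ≤ d → depth Φ ≤ d →
    ScaledPower≤ ∣ H ∣ q (times d (minusOne (root d μ))) (size Φ * q ^ dimV))
    × ScaledPower≤ ∣ H ∣ q (log₂ μ) (size Φ * q ^ dimV)
theorem7p7 p t q k isPrime 1≤t q≡p^t _ H W V⊂W r dimV dimW μ isMu Φ inv nonconst =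
  (λ { (suc d) _ depth≤ → lower-bound isPrime 1≤t q≡p^t root-admissible (suc d) Φ depth≤
         (hypotheses isPrime 1≤t q≡p^t H W V⊂W dimV dimW isMu inv nonconst) }) ,
  -- The exponent log₂ μ ignores the depth, so the depth of Φ itself serves as the bound.
  lower-bound isPrime 1≤t q≡p^t log-admissible (depth Φ) Φ ≤-refl
    (hypotheses isPrime 1≤t q≡p^t H W V⊂W dimV dimW isMu inv nonconst)
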